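{- Let $\mathcal{G}$ be a proper minor-closed family of graphs, and let $\mathcal{F}(n)$ be a family of functions closed under multiplication (such as $O(1)$ or $O(\mathrm{polylog}\, n)$). The following are equivalent: (a) every $n$-vertex graph in $\mathcal{G}$ has an $A\times B\times C$ three-dimensional drawing with $A,B\in\mathcal{F}(n)$ and $C\in O(n)$; (b) $\mathcal{G}$ has track-number $\mathrm{tn}(\mathcal{G})\in\mathcal{F}(n)$; (c) $\mathcal{G}$ has queue-number $\mathrm{qn}(\mathcal{G})\in\mathcal{F}(n)$.
   Context: All graphs are finite, simple and undirected. A family of graphs is minor-closed if it is closed under taking minors, and proper if it is not the class of all graphs. For a graph parameter $\alpha$ and a family $\mathcal{G}$, $\alpha(\mathcal{G})$ denotes the function $n\mapsto\max\{\alpha(G): G\in\mathcal{G}, |V(G)|=n\}$. A three-dimensional drawing of a graph represents the vertices by distinct points of $\mathbb{Z}^3$ and each edge by the straight line-segment between its end-vertices, such that edges intersect only at common end-vertices and an edge meets a vertex only if it is an end-vertex of that edge. It is an $X\times Y\times Z$ drawing if it is contained in an axis-aligned box with side lengths $X-1$, $Y-1$, $Z-1$. Track layouts: a colouring of $G$ is a partition $\{V_i:i\in I\}$ of $V(G)$ such that no edge has both end-vertices in the same class. A track assignment is a colouring together with a total order $<_i$ of each $V_i$ (each $(V_i,<_i)$ is a track). An X-crossing consists of two edges $vw$, $xy$ with $v,x\in V_i$, $w,y\in V_j$ for distinct tracks $i\neq j$, $v<_i x$ and $y<_j w$. A $t$-track layout is a track assignment with $t$ tracks and no X-crossing; the track-number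 $\mathrm{tn}(G)$ is the minimum such $t$. Queue layouts: a queue layout of $G$ is a total order $\sigma$ of $V(G)$ together with a partition of $E(G)$ into queues such that no queue contains edges $vw$, $xy$ with $v<_\sigma x<_\sigma y<_\sigma w$. The queue-number $\mathrm{qn}(G)$ is the minimum number of queues in a queue layout of $G$.
   Formalization: The family of functions is also assumed to contain the constant 1 and to be closed under O(·), as O(1) and O(polylog n) are; with closure under multiplication alone the claim fails, e.g. for the family {1} and edgeless graphs, where tn = 1 but qn = 0. -}

module Defs where

open import Data.Nat using (ℕ; zero; suc; _+_; _*_; _∸_; _≤_; _<_)
open import Data.Integer as ℤ using (ℤ; +_)
open import Data.Fin using (Fin; toℕ)
open import Data.Bool using (Bool; true; false)
open import Data.Maybe using (Maybe; just; nothing)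
open import Data.Product using (Σ; ∃; ∃-syntax; _×_; _,_)
open import Data.Sum using (_⊎_)
open import Relation.Nullary using (¬_)
import Data.Empty
open import Relation.Binary.PropositionalEquality using (_≡_; _≢_)
open import Function.Definitions using (Injective)

record Graph : Set where
  field
    n     : ℕ
    adj   : Fin n → Fin n → Bool
    sym   : ∀ u v → adj u v ≡ adj v u
    irr   : ∀ v → adj v v ≡ false

open Graph public

Edge : (G : Graph) → Fin (n G) → Fin (n G) → Set
Edge G u v = adj G u v ≡ true

data WalkIn (G : Graph) (S : Fin (n G) → Set) : Fin (n G) → Fin (n G) → Set where
  here : ∀ {u} → S u → WalkIn G S u u
  step : ∀ {u w v} → S u → Edge G u w → WalkIn G S w v → WalkIn G S u v

-- H is a minor of G: a map assigning each vertex of G to at most one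
-- branch set (so branch sets are disjoint), each branch set nonempty and
-- connected, and adjacent vertices of H have adjacent branch sets.
record MinorModel (H G : Graph) : Set where
  field
    φ         : Fin (n G) → Maybe (Fin (n H))
    nonempty  : ∀ h → ∃[ u ] (φ u ≡ just h)
    connected : ∀ h u v → φ u ≡ just h → φ v ≡ just h →
                WalkIn G (λ w → φ w ≡ just h) u v
    edges     : ∀ h h' → Edge H h h' →
                ∃[ u ] ∃[ v ] (φ u ≡ just h × φ v ≡ just h' × Edge G u v)

IsMinor : Graph → Graph → Set
IsMinor H G = MinorModel H G

GraphFamily : Set₁
GraphFamily = Graph → Set

MinorClosed : GraphFamily → Set
MinorClosed 𝒢 = ∀ G H → 𝒢 G → IsMinor H G → 𝒢 H

Proper : GraphFamily → Set
Proper 𝒢 = ∃[ G ] (¬ 𝒢 G)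

-- Track layouts.  A track assignment with t tracks: a proper colouring
-- with colours Fin t; the total order on each track is induced by an
-- injective ranking of all vertices.

record TrackLayout (G : Graph) (t : ℕ) : Set where
  field
    track    : Fin (n G) → Fin t
    proper   : ∀ u v → Edge G u v → track u ≢ track v
    rank     : Fin (n G) → ℕ
    rank-inj : Injective _≡_ _≡_ rank
    noX      : ∀ v w x y → Edge G v w → Edge G x y →
               track v ≡ track x → track w ≡ track y →
               rank v < rank x → rank y < rank w → Data.Empty.⊥

record QueueLayout (G : Graph) (k : ℕ) : Set where
  field
    σ        : Fin (n G) → ℕ
    σ-inj    : Injective _≡_ _≡_ σ
    queue    : Fin (n G) → Fin (n G) → Fin k
    queue-sym : ∀ v w → Edge G v w → queue v w ≡ queue w v
    nonest   : ∀ v w x y → Edge G v w → Edge G x y →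
               σ v < σ x → σ x < σ y → σ y < σ w →
               queue v w ≢ queue x y

Point : Set
Point = ℤ × ℤ × ℤ

_·_ : ℤ → Point → Point
c · (x , y , z) = (c ℤ.* x , c ℤ.* y , c ℤ.* z)

_⊕_ : Point → Point → Point
(x , y , z) ⊕ (x' , y' , z') = (x ℤ.+ x' , y ℤ.+ y' , z ℤ.+ z')

-- The rational point P/d (d > 0) lies on the closed segment [a,b]:
-- P/d = ((q-s)/q) a + (s/q) b for some 0 ≤ s ≤ q, q > 0.
OnSeg : ℕ → Point → Point → Point → Set
OnSeg d P a b = ∃[ q ] ∃[ s ] (0 < q × s ≤ q ×
  (+ q) · P ≡ (+ d) · (((+ (q ∸ s)) · a) ⊕ ((+ s) · b)))

toPoint : ∀ {X Y Z} → Fin X × Fin Y × Fin Z → Point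
toPoint (x , y , z) = (+ toℕ x , + toℕ y , + toℕ z)

-- An X × Y × Z drawing (vertices placed in the grid box
-- {0..X-1}×{0..Y-1}×{0..Z-1}, i.e. a box with side lengths X-1, Y-1, Z-1,
-- up to translation).
record Drawing (G : Graph) (X Y Z : ℕ) : Set where
  field
    pos     : Fin (n G) → Fin X × Fin Y × Fin Z
    pos-inj : Injective _≡_ _≡_ pos
    edgesOK : ∀ v w x y → Edge G v w → Edge G x y →
              ¬ (v ≡ x × w ≡ y) → ¬ (v ≡ y × w ≡ x) →
              ∀ d P → 0 < d →
              OnSeg d P (toPoint (pos v)) (toPoint (pos w)) →
              OnSeg d P (toPoint (pos x)) (toPoint (pos y)) →
              ∃[ z ] ((z ≡ v ⊎ z ≡ w) × (z ≡ x ⊎ z ≡ y) ×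
                      P ≡ (+ d) · toPoint (pos z))
    vertsOK : ∀ v w z → Edge G v w →
              OnSeg 1 (toPoint (pos z)) (toPoint (pos v)) (toPoint (pos w)) →
              z ≡ v ⊎ z ≡ w

_∈O_ : (ℕ → ℕ) → (ℕ → ℕ) → Set
g ∈O f = ∃[ c ] ∃[ N ] (∀ m → N ≤ m → g m ≤ c * f m)

-- A class of functions like O(1) or O(polylog n): closed under O(·)
-- (hence a genuine asymptotic class), containing O(1), and closed under
-- multiplication.
record FunctionClass (F : (ℕ → ℕ) → Set) : Set where
  field
    closed-O   : ∀ f g → F f → g ∈O f → F g
    has-const  : F (λ _ → 1)
    closed-mul : ∀ f g → F f → F g → F (λ m → f m * g m)

DrawingCond : GraphFamily → ((ℕ → ℕ) → Set) → Set
DrawingCond 𝒢 F = ∃[ A ] ∃[ B ] ∃[ C ] (F A × F B × C ∈O (λ m → m) ×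
  (∀ G → 𝒢 G → Drawing G (A (n G)) (B (n G)) (C (n G))))

TrackCond : GraphFamily → ((ℕ → ℕ) → Set) → Set
TrackCond 𝒢 F = ∃[ f ] (F f × (∀ G → 𝒢 G → TrackLayout G (f (n G))))

QueueCond : GraphFamily → ((ℕ → ℕ) → Set) → Set
QueueCond 𝒢 F = ∃[ f ] (F f × (∀ G → 𝒢 G → QueueLayout G (f (n G))))

{-# OPTIONS --safe #-}
module Submission where

open import Defs renaming (n to order; sym to adj-sym; irr to adj-irr)
open import Data.Nat as ℕ using (ℕ; zero; suc; _+_; _*_; _^_; _!; _∸_; _/_; _%_; _≤_; _<_; z≤n; s≤s; NonZero; >-nonZero; nonTrivial⇒n>1)
open import Data.Nat.Properties hiding (_≟_)
open import Data.Nat.Divisibility as ℕ using (_∣_; ∣-refl; ∣-trans; *-pres-∣; *-monoʳ-∣; ∣m+n∣m⇒∣n; m≤n⇒m!∣n!; m∣m*n; ∣⇒≤; 1∣_)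
open import Data.Nat.DivMod using (m≡m%n+[m/n]*n; m%n<n; /-monoˡ-≤; m/n*n≤m)
open import Data.Nat.ListAction using (product)
open import Data.Nat.Primality using (Prime; prime?; prime⇒nonZero; prime⇒nonTrivial; productOfPrimes≥1; euclidsLemma)
open import Data.Nat.Primality.Factorisation using (factorise; PrimeFactorisation)
open import Data.Nat.Tactic.RingSolver using (solve-∀)
open import Data.Integer as ℤ using (ℤ; +_; 0ℤ; ∣_∣) renaming (_+_ to _+ᶻ_; _*_ to _*ᶻ_; _-_ to _-ᶻ_; -_ to -ᶻ_)
import Data.Integer.Properties as ℤ
open import Data.Integer.Divisibility.Signed using (divides) renaming (_∣_ to _∣ᶻ_; ∣⇒∣ᵤ to ∣ᶻ⇒∣; ∣ᵤ⇒∣ to ∣⇒∣ᶻ)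
import Data.Integer.Tactic.RingSolver as ℤ-Solver
open import Data.Fin using (Fin; zero; suc; _≟_; combine; funToFin; finToFun; toℕ; fromℕ<; inject≤)
open import Data.Fin.Properties using (any?; pigeonhole; combine-injective; finToFun-funToFin; toℕ-injective; toℕ<n; toℕ-fromℕ<; fromℕ<-injective; inject≤-injective; ¬Fin0)
open import Data.Bool using (Bool; true; false; _∧_; if_then_else_)
import Data.Bool.Properties as Bool
open import Data.Maybe as Maybe using (Maybe; just; nothing; _>>=_; fromMaybe)
open import Data.Maybe.Properties using (just-injective; ≡-dec)
open import Data.List using ([]; _∷_)
open import Data.List.Relation.Unary.All using (All; []; _∷_)
open import Data.Product using (Σ; ∃-syntax; _×_; _,_; proj₁; proj₂)
open import Data.Sum using (_⊎_; inj₁; inj₂; swap; [_,_]′)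
open import Data.Empty using (⊥; ⊥-elim)
open import Function using (_∘_; id; mk⇔)
open import Function.Bundles using (_⇔_)
open import Function.Definitions using (Injective)
open import Relation.Nullary using (¬_; Dec; yes; no; does; contradiction)
open import Relation.Nullary.Decidable using (_×-dec_; ¬?; dec-true; dec-false; does-⇔; decidable-stable)
open import Relation.Binary.Definitions using (tri<; tri≈; tri>)
open import Relation.Binary.PropositionalEquality using (_≡_; _≢_; refl; sym; trans; cong; cong₂; subst; subst₂; ≢-sym; module ≡-Reasoning)
open import Algebra.Properties.CommutativeMonoid.Sum +-0-commutativeMonoid using (sum; sum-cong-≗; ∑-distrib-+; sum-replicate-zero)
open import Algebra.Properties.Semiring.Sum +-*-semiring using (*-distribˡ-sum)

-- A drawing is cut into columns of vertices with equal (x , y), and each column into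
-- two tracks by parity of height; an X-crossing of tracks in different columns would be
-- a crossing of edges in a vertical plane. A track layout becomes a queue layout by
-- concatenating the tracks. Conversely to the first step, vertices of the i-th track
-- are placed at (i² , i³ , z) with z ≡ i modulo a prime p, so that four vertices on
-- different tracks are never coplanar; cutting long tracks first keeps the height O(n).
-- For queues to tracks, Mader's theorem makes graphs in the family degenerate, and so
-- are their contractions; this yields star colourings with boundedly many colours, and
-- a track records the colour of a vertex together with the queue and direction of its
-- edge to the centre of every star it is a leaf of.

-- Only the step from queues to tracks uses the excluded graph; the other three constructions apply
-- to each graph on its own. In that step an X-crossing cannot occur once all edges between two
-- tracks lie in one queue and run the same way along the queue order, because then it would be a
-- nesting. The obstacle is that degrees are unbounded while a track may carry only boundedly many
-- records. So an edge is recorded at its leaf end alone, under the colour of the centre, and a star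
-- colouring guarantees that a leaf does not have two centres of one colour. Since the class of
-- functions is closed under products and constant factors, a construction may be polynomial in the
-- given parameter, with a degree that depends at most on the excluded graph. This is why crude
-- estimates suffice, such as a prime of order `t ^ 4`.

from-does : {P : Set} (d : Dec P) → does d ≡ true → P
from-does (yes p) _ = p

-- Finite sums and counting

sum-mono-≤ : ∀ {m} {f g : Fin m → ℕ} → (∀ i → f i ≤ g i) → sum f ≤ sum g
sum-mono-≤ {zero}  f≤g = z≤n
sum-mono-≤ {suc m} f≤g = +-mono-≤ (f≤g zero) (sum-mono-≤ (f≤g ∘ suc))

≤-sum : ∀ {m} (f : Fin m → ℕ) i → f i ≤ sum f
≤-sum f zero    = m≤m+n _ _
≤-sum f (suc i) = ≤-trans (≤-sum (f ∘ suc) i) (m≤n+m _ _)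

sum>0⇒∃>0 : ∀ {m} (f : Fin m → ℕ) → 1 ≤ sum f → ∃[ i ] 1 ≤ f i
sum>0⇒∃>0 {suc m} f le with f zero in eq
... | suc _ = zero , subst (1 ≤_) (sym eq) (s≤s z≤n)
... | zero  with i , p ← sum>0⇒∃>0 (f ∘ suc) le = suc i , p

ind : Bool → ℕ
ind b = if b then 1 else 0

count : ∀ {m} → (Fin m → Bool) → ℕ
count p = sum (ind ∘ p)

ind-mono : ∀ {a b} → (a ≡ true → b ≡ true) → ind a ≤ ind b
ind-mono {false} _ = z≤n
ind-mono {true}  f rewrite f refl = ≤-refl

ind>0⇒true : ∀ {a} → 1 ≤ ind a → a ≡ true
ind>0⇒true {true} _ = refl

-- When a contraction merges two adjacencies into one, a unit is lost only if both were present.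
ind-∨∧ : ∀ {a b c} → (a ≡ true → c ≡ true) → (b ≡ true → c ≡ true) →
         ind a + ind b ≤ ind c + ind (a ∧ b)
ind-∨∧ {false} {b} f g = ≤-trans (ind-mono g) (m≤m+n _ _)
ind-∨∧ {true}  {b} f g rewrite f refl = ≤-refl

count>0 : ∀ {m} {p : Fin m → Bool} i → p i ≡ true → 1 ≤ count p
count>0 {p = p} i pi = ≤-trans (≤-reflexive (cong ind (sym pi))) (≤-sum (ind ∘ p) i)

-- A point mass. Adding such terms on both sides lets a comparison of sums that fails at single
-- vertices be checked pointwise.
at : ∀ {m} → Fin m → ℕ → Fin m → ℕ
at i k j = if does (j ≟ i) then k else 0

sum-at : ∀ {m} (i : Fin m) k → sum (at i k) ≡ k
sum-at {suc m} zero    k = trans (cong (λ x → k + x) (sum-replicate-zero m)) (+-identityʳ k)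
sum-at {suc m} (suc i) k = trans (sum-cong-≗ at-suc) (sum-at i k)
  where
  at-suc : ∀ j → at (suc i) k (suc j) ≡ at i k j
  at-suc j with j ≟ i
  ... | yes _ = refl
  ... | no  _ = refl

sum-+-at : ∀ {m} (f : Fin m → ℕ) i k → sum (λ j → f j + at i k j) ≡ sum f + k
sum-+-at f i k = trans (∑-distrib-+ f (at i k)) (cong (λ x → sum f + x) (sum-at i k))

-- Walks and graphs

Walk-trans : ∀ {G S u v w} → WalkIn G S u v → WalkIn G S v w → WalkIn G S u w
Walk-trans (here _)     q = q
Walk-trans (step s e p) q = step s e (Walk-trans p q)

Walk-map : ∀ {G S T u v} → (∀ {w} → S w → T w) → WalkIn G S u v → WalkIn G T u v
Walk-map f (here s)     = here (f s)
Walk-map f (step s e p) = step (f s) e (Walk-map f p)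

edge-sym : ∀ (G : Graph) {u v} → Edge G u v → Edge G v u
edge-sym G {u} {v} e = trans (adj-sym G v u) e

edge-irr : ∀ (G : Graph) {v} → ¬ Edge G v v
edge-irr G {v} e with trans (sym (adj-irr G v)) e
... | ()

edge? : ∀ (G : Graph) u v → Dec (Edge G u v)
edge? G u v = adj G u v Bool.≟ true

graph : ∀ {m} (R : Fin m → Fin m → Set) → (∀ u v → Dec (R u v)) →
        (∀ {u v} → R u v → R v u) → (∀ {v} → ¬ R v v) → Graph
graph {m} R R? R-sym R-irr = record
  { n   = m
  ; adj = λ u v → does (R? u v)
  ; sym = λ u v → does-⇔ (mk⇔ R-sym R-sym) (R? u v) (R? v u)
  ; irr = λ v → dec-false (R? v v) R-irr
  }

-- Mader's theorem

-- Unlike in MinorModel, branch sets may be empty here. This lets every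
-- auxiliary graph live on the vertex set of G, unused vertices being isolated.
record _≼_ (H G : Graph) : Set where
  field
    φ         : Fin (order G) → Maybe (Fin (order H))
    connected : ∀ h u v → φ u ≡ just h → φ v ≡ just h → WalkIn G (λ w → φ w ≡ just h) u v
    edges     : ∀ h h' → Edge H h h' → ∃[ u ] ∃[ v ] (φ u ≡ just h × φ v ≡ just h' × Edge G u v)

-- With two or more branch sets, `edges` forces each of them to be nonempty.
record CliqueMinor (h : ℕ) (G : Graph) : Set where
  field
    φ         : Fin (order G) → Maybe (Fin h)
    connected : ∀ i u v → φ u ≡ just i → φ v ≡ just i → WalkIn G (λ w → φ w ≡ just i) u v
    edges     : ∀ i j → i ≢ j → ∃[ u ] ∃[ v ] (φ u ≡ just i × φ v ≡ just j × Edge G u v)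

CliqueMinor-≼ : ∀ {h H G} → CliqueMinor h H → H ≼ G → CliqueMinor h G
CliqueMinor-≼ {h} {H} {G} K M = record { φ = χ ; connected = conn ; edges = edg }
  where
  module K = CliqueMinor K
  module M = _≼_ M
  χ : Fin (order G) → Maybe (Fin h)
  χ u = M.φ u >>= K.φ
  χ-just : ∀ {u x i} → M.φ u ≡ just x → K.φ x ≡ just i → χ u ≡ just i
  χ-just p q rewrite p = q
  χ-inv : ∀ {u i} → χ u ≡ just i → ∃[ x ] (M.φ u ≡ just x × K.φ x ≡ just i)
  χ-inv {u} e with M.φ u
  ... | just x = x , refl , e
  -- Each edge of the walk in `H` is realised by an edge between two branch sets, and between
  -- consecutive such edges the walk stays inside one branch set.
  lift : ∀ {i x y} → WalkIn H (λ w → K.φ w ≡ just i) x y →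
         ∀ {u v} → M.φ u ≡ just x → M.φ v ≡ just y → WalkIn G (λ w → χ w ≡ just i) u v
  lift (here s) p q = Walk-map (λ r → χ-just r s) (M.connected _ _ _ p q)
  lift (step s e w) p q with a , b , a∈ , b∈ , ab ← M.edges _ _ e =
    Walk-trans (Walk-map (λ r → χ-just r s) (M.connected _ _ _ p a∈))
               (step (χ-just a∈ s) ab (lift w b∈ q))
  conn : ∀ i u v → χ u ≡ just i → χ v ≡ just i → WalkIn G (λ w → χ w ≡ just i) u v
  conn i u v p q with x , ux , xi ← χ-inv {u} p | y , vy , yi ← χ-inv {v} q =
    lift (K.connected i x y xi yi) ux vy
  edg : ∀ i j → i ≢ j → ∃[ u ] ∃[ v ] (χ u ≡ just i × χ v ≡ just j × Edge G u v)
  edg i j i≢j with x , y , xi , yj , xy ← K.edges i j i≢j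
                with u , v , ux , vy , uv ← M.edges x y xy =
    u , v , χ-just ux xi , χ-just vy yj , uv

module _ (G : Graph) where

  private V = Fin (order G)

  induced : (V → Bool) → Graph
  induced S = graph R (λ u v → edge? G u v ×-dec (S u Bool.≟ true) ×-dec (S v Bool.≟ true))
      (λ (e , s , t) → edge-sym G e , t , s) (λ (e , _) → edge-irr G e)
    where
    R : V → V → Set
    R u v = Edge G u v × S u ≡ true × S v ≡ true

  module _ {S : V → Bool} where

    induced-edge⁻ : ∀ {u v} → Edge (induced S) u v → Edge G u v × S u ≡ true × S v ≡ true
    induced-edge⁻ = from-does (edge? G _ _ ×-dec (S _ Bool.≟ true) ×-dec (S _ Bool.≟ true))

    induced-edge⁺ : ∀ {u v} → Edge G u v → S u ≡ true → S v ≡ true → Edge (induced S) u v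
    induced-edge⁺ e s t = dec-true (edge? G _ _ ×-dec (S _ Bool.≟ true) ×-dec (S _ Bool.≟ true)) (e , s , t)

  induced-≼ : ∀ S → induced S ≼ G
  induced-≼ S = record
    { φ = just
    ; connected = λ { h .h .h refl refl → here refl }
    ; edges = λ h h' e → h , h' , refl , refl , proj₁ (induced-edge⁻ {S} e)
    }

  module _ (κ : V → V) where

    private
      R : V → V → Set
      R x y = x ≢ y × ∃[ u ] ∃[ v ] (κ u ≡ x × κ v ≡ y × Edge G u v)
      R? : ∀ x y → Dec (R x y)
      R? x y = ¬? (x ≟ y) ×-dec
        any? (λ u → any? (λ v → (κ u ≟ x) ×-dec (κ v ≟ y) ×-dec edge? G u v))

    contraction : Graph
    contraction = graph R R?
      (λ (x≢y , u , v , p , q , e) → x≢y ∘ sym , v , u , q , p , edge-sym G e)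
      (λ (x≢x , _) → x≢x refl)

    contraction-edge⁺ : ∀ {u v} → κ u ≢ κ v → Edge G u v → Edge contraction (κ u) (κ v)
    contraction-edge⁺ ne e = dec-true (R? _ _) (ne , _ , _ , refl , refl , e)

    contraction-edge⁻ : ∀ {x y} → Edge contraction x y →
                        ∃[ u ] ∃[ v ] (κ u ≡ x × κ v ≡ y × Edge G u v)
    contraction-edge⁻ e = proj₂ (from-does (R? _ _) e)

    -- Each fibre of `κ` is a star around its image, so any two of its vertices are joined through
    -- the centre.
    contraction-≼ : (∀ u → κ u ≡ u ⊎ (Edge G u (κ u) × κ (κ u) ≡ κ u)) → contraction ≼ G
    contraction-≼ star = record
      { φ = just ∘ κ ; connected = conn
      ; edges = λ x y e → let u , v , p , q , uv = contraction-edge⁻ e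
                          in u , v , cong just p , cong just q , uv }
      where
      to : ∀ u → WalkIn G (λ w → just (κ w) ≡ just (κ u)) u (κ u)
      to u with star u
      ... | inj₁ p        = subst (WalkIn G (λ w → just (κ w) ≡ just (κ u)) u) (sym p) (here refl)
      ... | inj₂ (e , p)  = step refl e (here (cong just p))
      from : ∀ u → WalkIn G (λ w → just (κ w) ≡ just (κ u)) (κ u) u
      from u with star u
      ... | inj₁ p        = subst (λ x → WalkIn G (λ w → just (κ w) ≡ just (κ u)) x u) (sym p) (here refl)
      ... | inj₂ (e , p)  = step (cong just p) (edge-sym G e) (here refl)
      conn : ∀ h u v → just (κ u) ≡ just h → just (κ v) ≡ just h →
             WalkIn G (λ w → just (κ w) ≡ just h) u v
      conn h u v refl q = Walk-trans (to u)
        (subst (λ x → WalkIn G (λ w → just (κ w) ≡ just (κ u)) x v) (just-injective q)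
          (Walk-map (λ r → trans r q) (from v)))

  deg : V → ℕ
  deg u = count (adj G u)

  common : V → V → ℕ
  common u v = count (λ x → adj G u x ∧ adj G v x)

∧-true : ∀ {a b} → a ∧ b ≡ true → a ≡ true × b ≡ true
∧-true {true} {true} _ = refl , refl

module Contract (G : Graph) (u v : Fin (order G)) (uv : Edge G u v) where

  κ : Fin (order G) → Fin (order G)
  κ x with x ≟ v
  ... | yes _ = u
  ... | no  _ = x

  u≢v : u ≢ v
  u≢v refl = edge-irr G uv

  κ-v : κ v ≡ u
  κ-v with v ≟ v
  ... | yes _ = refl
  ... | no ¬p = contradiction refl ¬p

  κ-≢ : ∀ {x} → x ≢ v → κ x ≡ x
  κ-≢ {x} p with x ≟ v
  ... | yes q = contradiction q p
  ... | no  _ = refl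

  κ≢v : ∀ x → κ x ≢ v
  κ≢v x with x ≟ v
  ... | yes _ = u≢v
  ... | no  p = p

  G/uv : Graph
  G/uv = contraction G κ

  G/uv-≼ : G/uv ≼ G
  G/uv-≼ = contraction-≼ G κ star
    where
    star : ∀ x → κ x ≡ x ⊎ (Edge G x (κ x) × κ (κ x) ≡ κ x)
    star x with x ≟ v
    ... | yes refl = inj₂ (edge-sym G uv , κ-≢ u≢v)
    ... | no  _    = inj₁ refl

  edge-kept : ∀ {x y} → x ≢ v → y ≢ v → Edge G x y → Edge G/uv x y
  edge-kept {x} {y} p q e = subst₂ (Edge G/uv) (κ-≢ p) (κ-≢ q)
    (contraction-edge⁺ G κ (λ r → x≢y (trans (sym (κ-≢ p)) (trans r (κ-≢ q)))) e)
    where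
    x≢y : x ≢ y
    x≢y refl = edge-irr G e

  edge-moved : ∀ {y} → y ≢ v → y ≢ u → Edge G v y → Edge G/uv u y
  edge-moved {y} p q e = subst₂ (Edge G/uv) κ-v (κ-≢ p)
    (contraction-edge⁺ G κ (λ r → q (trans (sym (κ-≢ p)) (trans (sym r) κ-v))) e)

  private
    c : ℕ
    c = common G u v
    C : Fin (order G) → ℕ
    C x = ind (adj G u x ∧ adj G v x)

  -- The adjacency of `x` with `v` is shifted to `u` by the point mass `k`; a unit disappears there
  -- only if `x` is a common neighbour.
  deg-other : ∀ x → x ≢ u → x ≢ v → deg G x ≤ deg G/uv x + C x
  deg-other x x≢u x≢v = +-cancelʳ-≤ k _ _ (begin
    deg G x + k                                  ≡⟨ sum-+-at _ u k ⟨
    sum (λ y → ind (adj G x y) + at u k y)       ≤⟨ sum-mono-≤ pt ⟩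
    sum (λ y → ind (adj G/uv x y) + at u (C x) y + at v k y) ≡⟨ sum-+-at _ v k ⟩
    sum (λ y → ind (adj G/uv x y) + at u (C x) y) + k ≡⟨ cong (_+ k) (sum-+-at _ u (C x)) ⟩
    deg G/uv x + C x + k                         ∎)
    where
    open ≤-Reasoning
    k = ind (adj G x v)
    pt : ∀ y → ind (adj G x y) + at u k y ≤ ind (adj G/uv x y) + at u (C x) y + at v k y
    pt y with y ≟ u | y ≟ v
    ... | yes refl | yes refl = contradiction refl u≢v
    ... | yes refl | no _ rewrite adj-sym G u x | adj-sym G v x
        | +-identityʳ (ind (adj G/uv x u) + ind (adj G x u ∧ adj G x v)) =
      ind-∨∧ {adj G x u} (edge-kept x≢v u≢v)
             (λ e → edge-sym G/uv (edge-moved x≢v x≢u (edge-sym G e)))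
    ... | no _ | yes refl rewrite +-identityʳ (ind (adj G x v)) = m≤n+m _ _
    ... | no _ | no y≢v rewrite +-identityʳ (ind (adj G x y)) =
      ≤-trans (ind-mono (edge-kept x≢v y≢v)) (≤-trans (m≤m+n _ 0) (m≤m+n _ 0))

  -- The 2 pays for the edge `uv`, which is counted from both of its ends and vanishes.
  deg-merged : deg G u + deg G v ≤ deg G/uv u + (c + 2)
  deg-merged = begin
    deg G u + deg G v                                ≡⟨ ∑-distrib-+ (ind ∘ adj G u) _ ⟨
    sum (λ y → ind (adj G u y) + ind (adj G v y))    ≤⟨ sum-mono-≤ pt ⟩
    sum (λ y → ind (adj G/uv u y) + C y + at u 1 y + at v 1 y) ≡⟨ sum-+-at _ v 1 ⟩
    sum (λ y → ind (adj G/uv u y) + C y + at u 1 y) + 1        ≡⟨ cong (_+ 1) (sum-+-at _ u 1) ⟩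
    sum (λ y → ind (adj G/uv u y) + C y) + 1 + 1     ≡⟨ cong (λ s → s + 1 + 1) (∑-distrib-+ (ind ∘ adj G/uv u) C) ⟩
    deg G/uv u + c + 1 + 1                           ≡⟨ lemma (deg G/uv u) c ⟩
    deg G/uv u + (c + 2)                             ∎
    where
    open ≤-Reasoning
    lemma : ∀ a b → a + b + 1 + 1 ≡ a + (b + 2)
    lemma = solve-∀
    ind≤1 : ∀ b → ind b ≤ 1
    ind≤1 true  = ≤-refl
    ind≤1 false = z≤n
    pt : ∀ y → ind (adj G u y) + ind (adj G v y) ≤ ind (adj G/uv u y) + C y + at u 1 y + at v 1 y
    pt y with y ≟ u | y ≟ v
    ... | yes refl | yes refl = contradiction refl u≢v
    ... | yes refl | no _ rewrite adj-irr G u = ≤-trans (ind≤1 _) (≤-trans (m≤n+m 1 _) (m≤m+n _ 0))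
    ... | no _ | yes refl rewrite adj-irr G v | +-identityʳ (ind (adj G u v)) = ≤-trans (ind≤1 _) (m≤n+m 1 _)
    ... | no y≢u | no y≢v = ≤-trans (ind-∨∧ {adj G u y} (edge-kept u≢v y≢v) (edge-moved y≢v y≢u))
                              (≤-trans (m≤m+n _ 0) (m≤m+n _ 0))

  -- The contraction destroys the edge `uv` and one of the two edges to each common neighbour,
  -- `suc c` edges in all. Pointwise, the degree of `v` is transferred to `u`.
  degree-sum : sum (deg G) ≤ sum (deg G/uv) + 2 * suc c
  degree-sum = +-cancelʳ-≤ d _ _ (begin
    sum (deg G) + d                                       ≡⟨ sum-+-at _ u d ⟨
    sum (λ x → deg G x + at u d x)                        ≤⟨ sum-mono-≤ pt ⟩
    sum (λ x → deg G/uv x + C x + at u (c + 2) x + at v d x)   ≡⟨ sum-+-at _ v d ⟩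
    sum (λ x → deg G/uv x + C x + at u (c + 2) x) + d     ≡⟨ cong (_+ d) (sum-+-at _ u (c + 2)) ⟩
    sum (λ x → deg G/uv x + C x) + (c + 2) + d            ≡⟨ cong (λ s → s + (c + 2) + d) (∑-distrib-+ (deg G/uv) C) ⟩
    sum (deg G/uv) + c + (c + 2) + d                      ≡⟨ lemma (sum (deg G/uv)) c d ⟩
    sum (deg G/uv) + 2 * suc c + d                        ∎)
    where
    open ≤-Reasoning
    d = deg G v
    lemma : ∀ a c d → a + c + (c + 2) + d ≡ a + 2 * suc c + d
    lemma = solve-∀
    pt : ∀ x → deg G x + at u d x ≤ deg G/uv x + C x + at u (c + 2) x + at v d x
    pt x with x ≟ u | x ≟ v
    ... | yes refl | yes refl = contradiction refl u≢v
    ... | yes refl | no _ = ≤-trans deg-merged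
           (≤-trans (+-monoˡ-≤ (c + 2) (m≤m+n (deg G/uv u) (C u))) (m≤m+n _ 0))
    ... | no _ | yes refl rewrite +-identityʳ (deg G v) = m≤n+m _ _
    ... | no x≢u | no x≢v rewrite +-identityʳ (deg G x) =
           ≤-trans (deg-other x x≢u x≢v) (≤-trans (m≤m+n _ 0) (m≤m+n _ 0))

module _ (G : Graph) where

  private V = Fin (order G)

  -- The vertex `v` dominates its neighbourhood and forms a branch set by itself. Starting from at
  -- least two branch sets makes each of them contain a neighbour of `v`.
  CliqueMinor-cone : ∀ {h} (v : V) → CliqueMinor (2 + h) (induced G (adj G v)) → CliqueMinor (3 + h) G
  CliqueMinor-cone {h} v K = record { φ = χ ; connected = conn ; edges = edg }
    where
    module K = CliqueMinor K
    N : V → Set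
    N x = Edge G v x
    χ : V → Maybe (Fin (3 + h))
    χ x with x ≟ v | edge? G v x
    ... | yes _ | _     = just zero
    ... | no _  | yes _ = Maybe.map suc (K.φ x)
    ... | no _  | no _  = nothing
    χ-v : χ v ≡ just zero
    χ-v with v ≟ v
    ... | yes _ = refl
    ... | no ¬p = contradiction refl ¬p
    χ-zero : ∀ {x} → χ x ≡ just zero → x ≡ v
    χ-zero {x} e with x ≟ v | edge? G v x
    ... | yes p | _ = p
    ... | no _  | yes _ with K.φ x | e
    ...   | just _  | ()
    ...   | nothing | ()
    χ-suc⁺ : ∀ {x i} → N x → K.φ x ≡ just i → χ x ≡ just (suc i)
    χ-suc⁺ {x} vx p with x ≟ v | edge? G v x
    ... | yes refl | _ = contradiction vx (edge-irr G)
    ... | no _ | yes _ = cong (Maybe.map suc) p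
    ... | no _ | no ¬e = contradiction vx ¬e
    χ-suc⁻ : ∀ {x i} → χ x ≡ just (suc i) → N x × K.φ x ≡ just i
    χ-suc⁻ {x} e with x ≟ v | edge? G v x
    ... | yes _ | _ with () ← e
    ... | no _ | yes vx with K.φ x | e
    ...   | just _  | refl = vx , refl
    lift : ∀ {i x y} → N x → WalkIn (induced G (adj G v)) (λ w → K.φ w ≡ just i) x y →
           WalkIn G (λ w → χ w ≡ just (suc i)) x y
    lift vx (here s) = here (χ-suc⁺ vx s)
    lift vx (step s e p) with xw , _ , vw ← induced-edge⁻ G {adj G v} e = step (χ-suc⁺ vx s) xw (lift vw p)
    conn : ∀ i x y → χ x ≡ just i → χ y ≡ just i → WalkIn G (λ w → χ w ≡ just i) x y
    conn zero x y p q with refl ← χ-zero {x} p | refl ← χ-zero {y} q = here p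
    conn (suc i) x y p q with vx , xi ← χ-suc⁻ {x} p | vy , yi ← χ-suc⁻ {y} q =
      lift vx (K.connected i x y xi yi)
    other : ∀ (i : Fin (2 + h)) → ∃[ j ] i ≢ j
    other zero    = suc zero , λ ()
    other (suc i) = zero , λ ()
    member : ∀ i → ∃[ x ] (N x × χ x ≡ just (suc i))
    member i with j , i≢j ← other i with x , y , xi , _ , xy ← K.edges i j i≢j
      with _ , vx , _ ← induced-edge⁻ G {adj G v} xy = x , vx , χ-suc⁺ vx xi
    edg : ∀ i j → i ≢ j → ∃[ x ] ∃[ y ] (χ x ≡ just i × χ y ≡ just j × Edge G x y)
    edg zero    zero    i≢j = contradiction refl i≢j
    edg zero    (suc j) _ with y , vy , yj ← member j = v , y , χ-v , yj , vy
    edg (suc i) zero    _ with x , vx , xi ← member i = x , v , xi , χ-v , edge-sym G vx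
    edg (suc i) (suc j) i≢j with x , y , xi , yj , xy ← K.edges i j (i≢j ∘ cong suc)
      with xy , vx , vy ← induced-edge⁻ G {adj G v} xy = x , y , χ-suc⁺ vx xi , χ-suc⁺ vy yj , xy

  edge⇒CliqueMinor : ∀ {u v} → Edge G u v → CliqueMinor 2 G
  edge⇒CliqueMinor {u} {v} uv = record { φ = χ ; connected = conn ; edges = edg }
    where
    χ : V → Maybe (Fin 2)
    χ x with x ≟ u | x ≟ v
    ... | yes _ | _     = just zero
    ... | no _  | yes _ = just (suc zero)
    ... | no _  | no _  = nothing
    χ-u : χ u ≡ just zero
    χ-u with u ≟ u
    ... | yes _ = refl
    ... | no ¬p = contradiction refl ¬p
    χ-v : χ v ≡ just (suc zero)
    χ-v with v ≟ u | v ≟ v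
    ... | yes refl | _     = contradiction uv (edge-irr G)
    ... | no _     | yes _ = refl
    ... | no _     | no ¬p = contradiction refl ¬p
    end : Fin 2 → V
    end zero    = u
    end (suc _) = v
    χ⁻ : ∀ {x i} → χ x ≡ just i → x ≡ end i
    χ⁻ {x} e with x ≟ u | x ≟ v | e
    ... | yes p | _     | refl = p
    ... | no _  | yes p | refl = p
    ... | no _  | no _  | ()
    conn : ∀ i x y → χ x ≡ just i → χ y ≡ just i → WalkIn G (λ w → χ w ≡ just i) x y
    conn i x y p q with refl ← χ⁻ {x} p | refl ← χ⁻ {y} q = here p
    edg : ∀ i j → i ≢ j → ∃[ x ] ∃[ y ] (χ x ≡ just i × χ y ≡ just j × Edge G x y)
    edg zero       zero       i≢j = contradiction refl i≢j
    edg zero       (suc zero) _   = u , v , χ-u , χ-v , uv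
    edg (suc zero) zero       _   = v , u , χ-v , χ-u , edge-sym G uv
    edg (suc zero) (suc zero) i≢j = contradiction refl i≢j

degree-sum>0⇒edge : ∀ G → 1 ≤ sum (deg G) → ∃[ u ] ∃[ v ] Edge G u v
degree-sum>0⇒edge G p with u , q ← sum>0⇒∃>0 (deg G) p
                      with v , r ← sum>0⇒∃>0 (ind ∘ adj G u) q = u , v , ind>0⇒true r

-- `S` plays the role of the vertex set: it shrinks under contraction while the type of vertices
-- stays fixed. The last hypothesis says that the average degree over `S` is at least `2 ^ k`.
DenseCliqueMinor : ℕ → ℕ → Set
DenseCliqueMinor k s = ∀ G (S : Fin (order G) → Bool) →
  count S ≡ suc s → (∀ {u v} → Edge G u v → S u ≡ true) →
  2 ^ k * suc s ≤ sum (deg G) → CliqueMinor (2 + k) G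

-- For an edge `vx`, the common neighbours of its ends are the neighbours of `x` inside the
-- neighbourhood of `v`, so `many` is a lower bound for degrees there.
neighbourhood-step : ∀ k G → (∀ s → DenseCliqueMinor k s) → 1 ≤ sum (deg G) →
  (∀ {u v} → Edge G u v → 2 ^ k ≤ common G u v) → CliqueMinor (3 + k) G
neighbourhood-step k G ih nonempty many
  with v , w , vw ← degree-sum>0⇒edge G nonempty
  with count (adj G v) in eq | count>0 {p = adj G v} w vw
... | suc d | _ = CliqueMinor-cone G v
        (ih d N (adj G v) eq (λ e → proj₁ (proj₂ (induced-edge⁻ G {adj G v} e))) dense)
  where
  N : Graph
  N = induced G (adj G v)
  pt : ∀ x b → adj G v x ≡ b → 2 ^ k * ind b ≤ deg N x
  pt x false _  = ≤-trans (≤-reflexive (*-zeroʳ (2 ^ k))) z≤n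
  pt x true  vx = begin
      2 ^ k * 1      ≡⟨ *-identityʳ (2 ^ k) ⟩
      2 ^ k          ≤⟨ many vx ⟩
      common G v x   ≤⟨ sum-mono-≤ {order G} (λ y → ind-mono (λ e → let vy , xy = ∧-true e in induced-edge⁺ G xy vx vy)) ⟩
      deg N x        ∎
    where open ≤-Reasoning
  dense : 2 ^ k * suc d ≤ sum (deg N)
  dense = begin
      2 ^ k * suc d                              ≡⟨ cong (2 ^ k *_) eq ⟨
      2 ^ k * count (adj G v)                    ≡⟨ *-distribˡ-sum (2 ^ k) (ind ∘ adj G v) ⟩
      sum (λ x → 2 ^ k * ind (adj G v x))        ≤⟨ sum-mono-≤ (λ x → pt x _ refl) ⟩
      sum (deg N)                                ∎
    where open ≤-Reasoning

_∖_ : ∀ {m} → (Fin m → Bool) → Fin m → Fin m → Bool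
(S ∖ v) x = if does (x ≟ v) then false else S x

count-∖ : ∀ {m} (S : Fin m → Bool) v → S v ≡ true → count S ≡ suc (count (S ∖ v))
count-∖ S v v∈S = trans (sum-cong-≗ pt) (trans (sum-+-at (ind ∘ (S ∖ v)) v 1) (+-comm _ 1))
  where
  pt : ∀ x → ind (S x) ≡ ind ((S ∖ v) x) + at v 1 x
  pt x with x ≟ v
  ... | yes refl rewrite v∈S = refl
  ... | no _     = sym (+-identityʳ _)

module ContractionStep (k s : ℕ) (G : Graph) (S : Fin (order G) → Bool)
  (|S| : count S ≡ suc s) (supp : ∀ {u v} → Edge G u v → S u ≡ true)
  (dense : 2 ^ suc k * suc s ≤ sum (deg G))
  (u v : Fin (order G)) (uv : Edge G u v) (few : common G u v < 2 ^ k) where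

  open Contract G u v uv public

  S′ : Fin (order G) → Bool
  S′ = S ∖ v

  |S′| : count S′ ≡ s
  |S′| = suc-injective (trans (sym (count-∖ S v (supp (edge-sym G uv)))) |S|)

  supp′ : ∀ {x y} → Edge G/uv x y → S′ x ≡ true
  supp′ e with x′ , y′ , refl , _ , e′ ← contraction-edge⁻ G κ e with κ x′ ≟ v
  ... | yes p = contradiction p (κ≢v x′)
  ... | no _  with x′ ≟ v
  ...   | yes _ = supp uv
  ...   | no  _ = supp e′

  S′-inhabited : 1 ≤ count S′
  S′-inhabited = count>0 {p = S′} u u∈S′
    where
    u∈S′ : S′ u ≡ true
    u∈S′ rewrite dec-false (u ≟ v) u≢v = supp uv

  -- With one vertex fewer the requirement drops by `2 ^ suc k`, and the degree sum drops by no
  -- more, since there are fewer than `2 ^ k` common neighbours.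
  dense′ : 2 ^ suc k * s ≤ sum (deg G/uv)
  dense′ = +-cancelʳ-≤ (2 ^ suc k) _ _ (begin
    2 ^ suc k * s + 2 ^ suc k               ≡⟨ trans (+-comm _ (2 ^ suc k)) (sym (*-suc (2 ^ suc k) s)) ⟩
    2 ^ suc k * suc s                       ≤⟨ dense ⟩
    sum (deg G)                             ≤⟨ degree-sum ⟩
    sum (deg G/uv) + 2 * suc (common G u v) ≤⟨ +-monoʳ-≤ (sum (deg G/uv)) (*-monoʳ-≤ 2 few) ⟩
    sum (deg G/uv) + 2 ^ suc k              ∎)
    where open ≤-Reasoning

-- Mader's argument: contract an edge with fewer than 2 ^ k common neighbours;
-- if there is none, all neighbourhoods have minimum degree at least 2 ^ k.
contract-or-neighbourhood : ∀ k → (∀ s → DenseCliqueMinor k s) → ∀ s → DenseCliqueMinor (suc k) s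
contract-or-neighbourhood k ih s G S |S| supp dense
  with any? (λ u → any? (λ v → edge? G u v ×-dec (common G u v <? 2 ^ k)))
contract-or-neighbourhood k ih s G S |S| supp dense | no none =
  neighbourhood-step k G ih
    (≤-trans (*-mono-≤ (m^n>0 2 (suc k)) (s≤s z≤n)) dense)
    (λ {u} {v} uv → ≮⇒≥ (λ lt → none (u , v , uv , lt)))
-- Both ends of the edge lie in `S`, so `S` cannot be a singleton.
contract-or-neighbourhood k ih zero G S |S| supp dense | yes (u , v , uv , few) =
  contradiction (subst (1 ≤_) |S′| S′-inhabited) λ ()
  where open ContractionStep k zero G S |S| supp dense u v uv few
contract-or-neighbourhood k ih (suc s) G S |S| supp dense | yes (u , v , uv , few) =
  CliqueMinor-≼ (contract-or-neighbourhood k ih s G/uv S′ |S′| supp′ dense′) G/uv-≼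
  where open ContractionStep k (suc s) G S |S| supp dense u v uv few

dense⇒CliqueMinor : ∀ k s → DenseCliqueMinor k s
dense⇒CliqueMinor zero s G S _ _ dense
  with u , v , e ← degree-sum>0⇒edge G (≤-trans (s≤s z≤n) dense) = edge⇒CliqueMinor G e
dense⇒CliqueMinor (suc k) = contract-or-neighbourhood k (dense⇒CliqueMinor k)

-- Star colourings of graphs without a clique minor

-- There are exactly `d` slots, spare ones holding `nothing`, so that a slot number is an index from
-- a fixed finite set.
record Enumeration {m} (d : ℕ) (p : Fin m → Bool) : Set where
  field
    list     : Fin d → Maybe (Fin m)
    sound    : ∀ {i v} → list i ≡ just v → p v ≡ true
    complete : ∀ {v} → p v ≡ true → ∃[ i ] list i ≡ just v

enumerate : ∀ {m} d (p : Fin m → Bool) → count p ≤ d → Enumeration d p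
enumerate {zero} d p _ = record { list = λ _ → nothing ; sound = λ () ; complete = λ { {()} } }
enumerate {suc m} d p le with p zero in p0
enumerate {suc m} d p le | false = record
  { list     = Maybe.map suc ∘ list
  ; sound    = λ {i} → sound′ {i}
  ; complete = complete′ }
  where
  open Enumeration (enumerate d (p ∘ suc) le)
  sound′ : ∀ {i v} → Maybe.map suc (list i) ≡ just v → p v ≡ true
  sound′ {i} e with list i in eq
  sound′ refl | just w = sound eq
  complete′ : ∀ {v} → p v ≡ true → ∃[ i ] Maybe.map suc (list i) ≡ just v
  complete′ {zero}  pv with () ← trans (sym p0) pv
  complete′ {suc v} pv with i , e ← complete pv = i , cong (Maybe.map suc) e
enumerate {suc m} (suc d) p (s≤s le) | true = record
  { list = list′ ; sound = λ {i} → sound′ {i} ; complete = complete′ }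
  where
  open Enumeration (enumerate d (p ∘ suc) le)
  list′ : Fin (suc d) → Maybe (Fin (suc m))
  list′ zero    = just zero
  list′ (suc i) = Maybe.map suc (list i)
  sound′ : ∀ {i v} → list′ i ≡ just v → p v ≡ true
  sound′ {zero} refl = p0
  sound′ {suc i} e with list i in eq
  sound′ {suc i} refl | just w = sound eq
  complete′ : ∀ {v} → p v ≡ true → ∃[ i ] list′ i ≡ just v
  complete′ {zero}  _  = zero , refl
  complete′ {suc v} pv with i , e ← complete pv = suc i , cong (Maybe.map suc) e

free-colour : ∀ {d} (used : Fin d → Maybe (Fin (suc d))) → ∃[ c ] (∀ i → used i ≢ just c)
free-colour {d} used with any? (λ c → ¬? (any? (λ i → ≡-dec _≟_ (used i) (just c))))
... | yes (c , free) = c , λ i e → free (i , e)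
... | no all-used =
  let c , c′ , c<c′ , eq = pigeonhole (n<1+n d) (proj₁ ∘ user)
      c≡c′ = just-injective (trans (sym (proj₂ (user c))) (trans (cong used eq) (proj₂ (user c′))))
  in contradiction c<c′ (<-irrefl (cong toℕ c≡c′))
  where
  user : ∀ c → ∃[ i ] used i ≡ just c
  user c = decidable-stable (any? (λ i → ≡-dec _≟_ (used i) (just c))) (λ ¬u → all-used (c , ¬u))

-- A witness of d-degeneracy: the acyclic orientation towards earlier vertices
-- has out-degree at most d, and greedy colouring uses d + 1 colours.
record Degenerate (d : ℕ) (G : Graph) : Set where
  field
    out      : Fin (order G) → Fin d → Maybe (Fin (order G))
    colour   : Fin (order G) → Fin (suc d)
    out-edge : ∀ {u v i} → out u i ≡ just v → Edge G u v
    orient   : ∀ {u v} → Edge G u v → (∃[ i ] out u i ≡ just v) ⊎ (∃[ i ] out v i ≡ just u)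
    proper   : ∀ {u v} → Edge G u v → colour u ≢ colour v

Degenerate-⊆ : ∀ {d G} S → (∀ {u v} → Edge G u v → S u ≡ true) → Degenerate d (induced G S) → Degenerate d G
Degenerate-⊆ {d} {G} S supp D = record
  { out = out ; colour = colour
  ; out-edge = λ p → proj₁ (induced-edge⁻ G {S} (out-edge p))
  ; orient = orient ∘ kept ; proper = proper ∘ kept }
  where
  open Degenerate D
  kept : ∀ {u v} → Edge G u v → Edge (induced G S) u v
  kept e = induced-edge⁺ G e (supp e) (supp (edge-sym G e))

-- Otherwise all degrees within `S` exceed `2 ^ k`, hence so does the average, and Mader's theorem
-- yields the excluded clique minor.
low-degree-vertex : ∀ k G → ¬ CliqueMinor (2 + k) G → ∀ {s} (S : Fin (order G) → Bool) → count S ≡ suc s →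
                    ∃[ v ] (S v ≡ true × deg (induced G S) v ≤ 2 ^ k)
low-degree-vertex k G free {s} S |S|
  with any? (λ v → (S v Bool.≟ true) ×-dec (deg (induced G S) v ≤? 2 ^ k))
... | yes found = found
... | no none   = contradiction
  (CliqueMinor-≼ (dense⇒CliqueMinor k s (induced G S) S |S| (λ e → proj₁ (proj₂ (induced-edge⁻ G {S} e))) dense)
                 (induced-≼ G S)) free
  where
  pt : ∀ x b → S x ≡ b → 2 ^ k * ind b ≤ deg (induced G S) x
  pt x false _   = ≤-trans (≤-reflexive (*-zeroʳ (2 ^ k))) z≤n
  pt x true  x∈S = ≤-trans (≤-reflexive (*-identityʳ (2 ^ k)))
                           (<⇒≤ (≰⇒> (λ le → none (x , x∈S , le))))
  dense : 2 ^ k * suc s ≤ sum (deg (induced G S))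
  dense = begin
    2 ^ k * suc s                        ≡⟨ cong (2 ^ k *_) |S| ⟨
    2 ^ k * count S                      ≡⟨ *-distribˡ-sum (2 ^ k) (ind ∘ S) ⟩
    sum (λ x → 2 ^ k * ind (S x))        ≤⟨ sum-mono-≤ (λ x → pt x _ refl) ⟩
    sum (deg (induced G S))              ∎
    where open ≤-Reasoning

-- The vertex of low degree comes last: its arcs go to all its neighbours, and these forbid at most
-- `d` of the `suc d` colours.
add-vertex : ∀ {d} G S v → deg (induced G S) v ≤ d → Degenerate d (induced G (S ∖ v)) → Degenerate d (induced G S)
add-vertex {d} G S v low D =
  record { out = out′ ; colour = colour′ ; out-edge = out-edge′ ; orient = orient′ ; proper = proper′ }
  where
  open Degenerate D
  open Enumeration (enumerate d (adj (induced G S) v) low) renaming (list to nbrs)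
  c : Fin (suc d)
  c = proj₁ (free-colour (λ i → Maybe.map colour (nbrs i)))
  c-free : ∀ i → Maybe.map colour (nbrs i) ≢ just c
  c-free = proj₂ (free-colour (λ i → Maybe.map colour (nbrs i)))
  GS = induced G S
  V = Fin (order G)
  out′ : V → Fin d → Maybe V
  out′ u with u ≟ v
  ... | yes _ = nbrs
  ... | no  _ = out u
  colour′ : V → Fin (suc d)
  colour′ u with u ≟ v
  ... | yes _ = c
  ... | no  _ = colour u
  kept : ∀ {x y} → x ≢ v → y ≢ v → Edge GS x y → Edge (induced G (S ∖ v)) x y
  kept {x} {y} x≢v y≢v e with e , x∈S , y∈S ← induced-edge⁻ G {S} e =
    induced-edge⁺ G e (∖⁺ x≢v x∈S) (∖⁺ y≢v y∈S)
    where
    ∖⁺ : ∀ {x} → x ≢ v → S x ≡ true → (S ∖ v) x ≡ true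
    ∖⁺ {x} x≢v x∈S rewrite dec-false (x ≟ v) x≢v = x∈S
  out-edge′ : ∀ {x y i} → out′ x i ≡ just y → Edge GS x y
  out-edge′ {x} p with x ≟ v
  ... | yes refl = sound p
  ... | no _ with e , x∈ , y∈ ← induced-edge⁻ G {S ∖ v} (out-edge p) = induced-edge⁺ G e (∖⁻ x∈) (∖⁻ y∈)
    where
    ∖⁻ : ∀ {x} → (S ∖ v) x ≡ true → S x ≡ true
    ∖⁻ {x} p with x ≟ v
    ... | no _ = p
  orient′ : ∀ {x y} → Edge GS x y → (∃[ i ] out′ x i ≡ just y) ⊎ (∃[ i ] out′ y i ≡ just x)
  orient′ {x} {y} e with x ≟ v | y ≟ v
  ... | yes refl | _        = inj₁ (complete e)
  ... | no _     | yes refl = inj₂ (complete (edge-sym GS e))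
  ... | no x≢v   | no y≢v   = orient (kept x≢v y≢v e)
  free : ∀ {x} → Edge GS v x → colour x ≢ c
  free e x≡c with i , p ← complete e = c-free i (trans (cong (Maybe.map colour) p) (cong just x≡c))
  proper′ : ∀ {x y} → Edge GS x y → colour′ x ≢ colour′ y
  proper′ {x} {y} e with x ≟ v | y ≟ v
  ... | yes refl | yes refl = contradiction e (edge-irr GS)
  ... | yes refl | no _     = ≢-sym (free e)
  ... | no _     | yes refl = free (edge-sym GS e)
  ... | no x≢v   | no y≢v   = proper (kept x≢v y≢v e)

degenerate-induced : ∀ k G → ¬ CliqueMinor (2 + k) G → ∀ s S → count S ≡ s → Degenerate (2 ^ k) (induced G S)
degenerate-induced k G free zero S |S| = record
  { out = λ _ _ → nothing ; colour = λ _ → zero ; out-edge = λ ()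
  ; orient = λ e → contradiction e no-edge ; proper = λ e _ → no-edge e }
  where
  no-edge : ∀ {u v} → ¬ Edge (induced G S) u v
  no-edge {u} e = contradiction (subst (1 ≤_) |S| (count>0 {p = S} u (proj₁ (proj₂ (induced-edge⁻ G {S} e))))) λ ()
degenerate-induced k G free (suc s) S |S| with v , v∈S , low ← low-degree-vertex k G free S |S| =
  add-vertex G S v low (degenerate-induced k G free s (S ∖ v) (suc-injective (trans (sym (count-∖ S v v∈S)) |S|)))

degenerate : ∀ k G → ¬ CliqueMinor (2 + k) G → Degenerate (2 ^ k) G
degenerate k G free = Degenerate-⊆ (λ _ → true) (λ _ → refl) (degenerate-induced k G free _ (λ _ → true) refl)

-- A star colouring: an arc u → v says that v is the centre of the star which
-- the edge uv belongs to in the subgraph induced by the colours of u and v.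
record StarColouring (c : ℕ) (G : Graph) : Set₁ where
  field
    colour : Fin (order G) → Fin c
    Arc    : Fin (order G) → Fin (order G) → Set
    arc?   : ∀ u v → Dec (Arc u v)
    orient : ∀ {u v} → Edge G u v → Arc u v ⊎ Arc v u
    proper : ∀ {u v} → Edge G u v → colour u ≢ colour v
    star   : ∀ {u v w} → Arc v w → Edge G v u → colour u ≡ colour w → u ≡ w

funToFin-injective : ∀ {m k} (f g : Fin m → Fin k) → funToFin f ≡ funToFin g → ∀ i → f i ≡ g i
funToFin-injective f g eq i =
  trans (sym (finToFun-funToFin f i)) (trans (cong (λ x → finToFun x i) eq) (finToFun-funToFin g i))

-- One colour from `G` itself and, for each of its `suc (2 ^ k)` colours and each of the `2 ^ k`
-- slots, one colour from the corresponding contraction.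
starColours : ℕ → ℕ
starColours k = suc (2 ^ k) * (suc (2 ^ k) ^ (2 ^ k)) ^ suc (2 ^ k)

-- Contracting every vertex v of colour a into its i-th out-neighbour w makes w
-- adjacent to all other neighbours of v, so a proper colouring of this minor
-- separates them from w.
starColouring : ∀ k G → ¬ CliqueMinor (2 + k) G → StarColouring (starColours k) G
starColouring k G free = record
  { colour = colour ; Arc = λ u v → ∃[ i ] D.out u i ≡ just v
  ; arc? = λ u v → any? (λ i → ≡-dec _≟_ (D.out u i) (just v))
  ; orient = D.orient
  ; proper = λ e p → D.proper e (proj₁ (colour-injective p))
  ; star = star }
  where
  V = Fin (order G)
  C = Fin (suc (2 ^ k))
  module D = Degenerate (degenerate k G free)
  κ : C → Fin (2 ^ k) → V → V
  κ a i v = if does (D.colour v ≟ a) then fromMaybe v (D.out v i) else v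
  κ-≢ : ∀ {a i v} → D.colour v ≢ a → κ a i v ≡ v
  κ-≢ {a} {i} {v} ne rewrite dec-false (D.colour v ≟ a) ne = refl
  κ-≡ : ∀ {i v w} → D.out v i ≡ just w → κ (D.colour v) i v ≡ w
  κ-≡ {i} {v} p rewrite dec-true (D.colour v ≟ D.colour v) refl | p = refl
  -- Out-neighbours of vertices of colour `a` have other colours and stay fixed, so only stars are
  -- contracted.
  κ-star : ∀ a i u → κ a i u ≡ u ⊎ (Edge G u (κ a i u) × κ a i (κ a i u) ≡ κ a i u)
  κ-star a i u with D.colour u ≟ a
  ... | no _ = inj₁ refl
  ... | yes refl with D.out u i in p
  ...   | nothing = inj₁ refl
  ...   | just w  = inj₂ (D.out-edge p , κ-≢ (≢-sym (D.proper (D.out-edge p))))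
  H : C → Fin (2 ^ k) → Graph
  H a i = contraction G (κ a i)
  module DH a i = Degenerate (degenerate k (H a i)
                    (λ K → free (CliqueMinor-≼ K (contraction-≼ G (κ a i) (κ-star a i)))))
  colour : V → Fin (starColours k)
  colour v = combine (D.colour v) (funToFin (λ a → funToFin (λ i → DH.colour a i v)))
  colour-injective : ∀ {u v} → colour u ≡ colour v →
    D.colour u ≡ D.colour v × (∀ a i → DH.colour a i u ≡ DH.colour a i v)
  colour-injective {u} {v} p =
    let q , r = combine-injective (D.colour u) (funToFin (λ a → funToFin (λ i → DH.colour a i u)))
                                  (D.colour v) (funToFin (λ a → funToFin (λ i → DH.colour a i v))) p
    in q , λ a → funToFin-injective (λ i → DH.colour a i u) (λ i → DH.colour a i v) (funToFin-injective (λ a → funToFin (λ i → DH.colour a i u)) (λ a → funToFin (λ i → DH.colour a i v)) r a)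
  star : ∀ {u v w} → ∃[ i ] D.out v i ≡ just w → Edge G v u → colour u ≡ colour w → u ≡ w
  star {u} {v} {w} (i , p) vu same with u ≟ w
  ... | yes u≡w = u≡w
  ... | no  u≢w = contradiction
        (proj₂ (colour-injective same) a i)
        (DH.proper a i uw)
    where
    a = D.colour v
    κu≡u : κ a i u ≡ u
    κu≡u = κ-≢ (≢-sym (D.proper vu))
    uw : Edge (H a i) u w
    uw = subst₂ (Edge (H a i)) κu≡u (κ-≡ p)
      (contraction-edge⁺ G (κ a i) (λ e → u≢w (trans (sym κu≡u) (trans e (κ-≡ p)))) (edge-sym G vu))

-- Track layouts from queue layouts

queue⇒track : ∀ {c q G} → StarColouring c G → QueueLayout G q → TrackLayout G (c * suc (2 * q) ^ c)
queue⇒track {c} {q} {G} Star Q = record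
  { track = track ; proper = λ u v e p → proper e (track-colour p)
  ; rank = σ ; rank-inj = σ-inj ; noX = noX }
  where
  open StarColouring Star
  open QueueLayout Q
  V = Fin (order G)
  dir : V → V → Fin 2
  dir v w with σ v <? σ w
  ... | yes _ = zero
  ... | no _  = suc zero
  code : V → V → Fin (2 * q)
  code v w = combine (dir v w) (queue v w)
  centre? : ∀ v j → Dec (∃[ w ] (Arc v w × colour w ≡ j))
  centre? v j = any? (λ w → arc? v w ×-dec (colour w ≟ j))
  state : V → Fin c → Fin (suc (2 * q))
  state v j with centre? v j
  ... | yes (w , _) = suc (code v w)
  -- The extra value in `suc (2 * q)`: `v` is not a leaf of any star whose centre has colour `j`.
  ... | no _        = zero
  -- A leaf has no second neighbour of its centre's colour, so the centre found by the search must
  -- be `w`.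
  state⁻ : ∀ {v w j} → Edge G v w → colour w ≡ j → ∀ {x} → state v j ≡ suc x → Arc v w × code v w ≡ x
  state⁻ {v} {w} {j} e cw eq with centre? v j
  state⁻ e cw refl | yes (w′ , vw′ , cw′) with refl ← star vw′ e (trans cw (sym cw′)) = vw′ , refl
  state⁺ : ∀ {v w} → Edge G v w → Arc v w → state v (colour w) ≡ suc (code v w)
  state⁺ {v} {w} e vw with centre? v (colour w)
  ... | yes (w′ , vw′ , cw′) with refl ← star vw′ e (sym cw′) = refl
  ... | no none = contradiction (w , vw , refl) none
  track : V → Fin (c * suc (2 * q) ^ c)
  track v = combine (colour v) (funToFin (state v))
  track-colour : ∀ {u v} → track u ≡ track v → colour u ≡ colour v
  track-colour {u} {v} p = proj₁ (combine-injective (colour u) (funToFin (state u)) (colour v) _ p)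
  track-state : ∀ {u v} → track u ≡ track v → ∀ j → state u j ≡ state v j
  track-state {u} {v} p = funToFin-injective (state u) (state v) (proj₂ (combine-injective (colour u) (funToFin (state u)) (colour v) _ p))
  -- Equal tracks mean equal records for the colour shared by `w` and `y`. Hence all edges between
  -- two tracks agree in queue and direction.
  same-code : ∀ {v w x y} → Edge G v w → Edge G x y → Arc v w → track v ≡ track x → track w ≡ track y →
              code v w ≡ code x y
  same-code vw xy a p r = sym (proj₂ (state⁻ xy (sym (track-colour r)) (trans (sym (track-state p _)) (state⁺ vw a))))
  ≮∧edge⇒> : ∀ {v w} → Edge G v w → ¬ (σ v < σ w) → σ w < σ v
  ≮∧edge⇒> {v} {w} e nlt with <-cmp (σ v) (σ w)
  ... | tri< lt _ _ = contradiction lt nlt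
  ... | tri≈ _ eq _ with refl ← σ-inj eq = contradiction e (edge-irr G)
  ... | tri> _ _ gt = gt
  -- If both edges run forward, crossing means `v < x < y < w` in the order `σ`; if both run
  -- backward, `y < w < v < x`. Either way they nest in one queue.
  no-cross : ∀ {v w x y} → Edge G v w → Edge G x y → code v w ≡ code x y → σ v < σ x → σ y < σ w → ⊥
  no-cross {v} {w} {x} {y} vw xy same v<x y<w with combine-injective (dir v w) (queue v w) (dir x y) (queue x y) same
  ... | d , same-queue with σ v <? σ w | σ x <? σ y | d
  ... | yes _   | yes x<y | _ = nonest v w x y vw xy v<x x<y y<w same-queue
  ... | yes _   | no _    | ()
  ... | no _    | yes _   | ()
  ... | no v≮w  | no _    | _ = nonest y x w v (edge-sym G xy) (edge-sym G vw) y<w (≮∧edge⇒> vw v≮w) v<x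
                              (trans (sym (queue-sym x y xy)) (trans (sym same-queue) (queue-sym v w vw)))
  noX : ∀ v w x y → Edge G v w → Edge G x y → track v ≡ track x → track w ≡ track y → σ v < σ x → σ y < σ w → ⊥
  noX v w x y vw xy p r v<x y<w with orient vw
  ... | inj₁ a = no-cross vw xy (same-code vw xy a p r) v<x y<w
  ... | inj₂ a = no-cross yx wv (sym (same-code wv yx a r p)) y<w v<x
    where
    wv = edge-sym G vw
    yx = edge-sym G xy

-- Two branch sets are dropped; an edge to one of them witnesses that a remaining branch set is
-- nonempty.
CliqueMinor⇒IsMinor : ∀ G H → CliqueMinor (2 + order H) G → IsMinor H G
CliqueMinor⇒IsMinor G H K = record
  { φ = χ
  ; nonempty = λ h → let u , _ , uh , _ = edges (suc (suc h)) zero (λ ()) in u , χ⁺ uh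
  ; connected = λ h u v p q → Walk-map χ⁺ (connected _ u v (χ⁻ p) (χ⁻ q))
  ; edges = λ h h' e → let u , v , p , q , uv = edges (suc (suc h)) (suc (suc h')) (distinct e)
                       in u , v , χ⁺ p , χ⁺ q , uv
  }
  where
  open CliqueMinor K
  drop2 : Fin (2 + order H) → Maybe (Fin (order H))
  drop2 (suc (suc h)) = just h
  drop2 _             = nothing
  χ : Fin (order G) → Maybe (Fin (order H))
  χ u = φ u >>= drop2
  χ⁺ : ∀ {u h} → φ u ≡ just (suc (suc h)) → χ u ≡ just h
  χ⁺ p rewrite p = refl
  χ⁻ : ∀ {u h} → χ u ≡ just h → φ u ≡ just (suc (suc h))
  χ⁻ {u} p with φ u
  χ⁻ refl | just (suc (suc h)) = refl
  distinct : ∀ {h h'} → Edge H h h' → suc (suc h) ≢ suc (suc h')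
  distinct e refl = edge-irr H e

-- Lexicographic orders, and queue layouts from track layouts

module Lex {m} (track rank : Fin m → ℕ) (rank-inj : Injective _≡_ _≡_ rank) where

  private
    -- Larger than every rank, so `key` compares tracks before ranks.
    R : ℕ
    R = suc (sum rank)

  key : Fin m → ℕ
  key v = track v * R + rank v

  track<⇒key< : ∀ {u v} → track u < track v → key u < key v
  track<⇒key< {u} {v} lt = begin-strict
    track u * R + rank u  <⟨ +-monoʳ-< (track u * R) (s≤s (≤-sum rank u)) ⟩
    track u * R + R       ≡⟨ +-comm (track u * R) R ⟩
    suc (track u) * R     ≤⟨ *-monoˡ-≤ R lt ⟩
    track v * R           ≤⟨ m≤m+n _ (rank v) ⟩
    key v                 ∎
    where open ≤-Reasoning

  key<⇒track≤ : ∀ {u v} → key u < key v → track u ≤ track v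
  key<⇒track≤ lt = ≮⇒≥ (λ gt → <-asym lt (track<⇒key< gt))

  key<⇒rank< : ∀ {u v} → track u ≡ track v → key u < key v → rank u < rank v
  key<⇒rank< {u} {v} eq lt rewrite eq = +-cancelˡ-< (track v * R) _ _ lt

  key-inj : Injective _≡_ _≡_ key
  key-inj {u} {v} eq with <-cmp (track u) (track v)
  ... | tri< lt _ _ = contradiction eq (<⇒≢ (track<⇒key< lt))
  ... | tri> _ _ gt = contradiction (sym eq) (<⇒≢ (track<⇒key< gt))
  ... | tri≈ _ te _ rewrite te = rank-inj (+-cancelˡ-≡ (track v * R) _ _ eq)

-- A queue is an ordered pair of tracks, the track of the earlier end first. Nested edges of one
-- queue have their left ends on one track and their right ends on another, in opposite orders,
-- which is an X-crossing.
track⇒queue : ∀ {t G} → TrackLayout G t → QueueLayout G (t * t)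
track⇒queue {t} {G} T = record
  { σ = key ; σ-inj = key-inj ; queue = queue ; queue-sym = queue-sym ; nonest = nonest }
  where
  open TrackLayout T
  V = Fin (order G)
  open Lex (toℕ ∘ track) rank rank-inj
  queue : V → V → Fin (t * t)
  queue v w with key v <? key w
  ... | yes _ = combine (track v) (track w)
  ... | no _  = combine (track w) (track v)
  queue-< : ∀ {v w} → key v < key w → queue v w ≡ combine (track v) (track w)
  queue-< {v} {w} lt with key v <? key w
  ... | yes _  = refl
  ... | no nlt = contradiction lt nlt
  queue-sym : ∀ v w → Edge G v w → queue v w ≡ queue w v
  queue-sym v w e with key v <? key w | key w <? key v
  ... | yes lt | yes gt = contradiction gt (<-asym lt)
  ... | yes _  | no _   = refl
  ... | no _   | yes _  = refl
  ... | no nlt | no ngt with refl ← key-inj {v} {w} (≤-antisym (≮⇒≥ ngt) (≮⇒≥ nlt)) = contradiction e (edge-irr G)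
  nonest : ∀ v w x y → Edge G v w → Edge G x y → key v < key x → key x < key y → key y < key w →
           queue v w ≢ queue x y
  nonest v w x y vw xy v<x x<y y<w same
    with p , q ← combine-injective (track v) (track w) (track x) (track y)
           (trans (sym (queue-< (<-trans v<x (<-trans x<y y<w)))) (trans same (queue-< x<y))) =
    noX v w x y vw xy p q (key<⇒rank< (cong toℕ p) v<x) (key<⇒rank< (cong toℕ (sym q)) y<w)

-- Track layouts from drawings

parity : ℕ → Fin 2
parity zero          = zero
parity (suc zero)    = suc zero
parity (suc (suc k)) = parity k

parity-suc : ∀ k → parity k ≢ parity (suc k)
parity-suc zero          ()
parity-suc (suc zero)    ()
parity-suc (suc (suc k)) = parity-suc k

same-parity⇒gap : ∀ {a b} → parity a ≡ parity b → a < b → suc a < b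
same-parity⇒gap {a} eq lt = ≤∧≢⇒< lt λ { refl → parity-suc a eq }

point-≡ : ∀ {x y z x' y' z'} → x ≡ x' → y ≡ y' → z ≡ z' → _≡_ {A = Point} (x , y , z) (x' , y' , z')
point-≡ refl refl refl = refl

combination : ℤ → Point → ℤ → Point → Point
combination r P s Q = (r · P) ⊕ (s · Q)

on-vertical-segment : ∀ x y z s r → (s ℤ.+ r) · (x , y , z ℤ.+ s) ≡
  (+ 1) · combination r (x , y , z) s (x , y , z ℤ.+ s ℤ.+ r)
on-vertical-segment x y z s r = point-≡ (flat s r x) (flat s r y) (slope s r z)
  where
  flat : ∀ s r a → (s ℤ.+ r) ℤ.* a ≡ ℤ.1ℤ ℤ.* (r ℤ.* a ℤ.+ s ℤ.* a)
  flat = ℤ-Solver.solve-∀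
  slope : ∀ s r a → (s ℤ.+ r) ℤ.* (a ℤ.+ s) ≡ ℤ.1ℤ ℤ.* (r ℤ.* a ℤ.+ s ℤ.* (a ℤ.+ s ℤ.+ r))
  slope = ℤ-Solver.solve-∀

-- The diagonals of a trapezium with vertical sides of lengths r and s.
crossing-point : ∀ x y x' y' a b r s →
  combination s (x , y , a) r (x' , y' , b ℤ.+ s) ≡ combination s (x , y , a ℤ.+ r) r (x' , y' , b)
crossing-point x y x' y' a b r s = point-≡ refl refl (eq a b r s)
  where
  eq : ∀ a b r s → s ℤ.* a ℤ.+ r ℤ.* (b ℤ.+ s) ≡ s ℤ.* (a ℤ.+ r) ℤ.+ r ℤ.* b
  eq = ℤ-Solver.solve-∀

module _ {G : Graph} {A B C : ℕ} (D : Drawing G A B C) where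

  open Drawing D

  private
    V = Fin (order G)

    column : V → Fin (A * B)
    column v = combine (proj₁ (pos v)) (proj₁ (proj₂ (pos v)))

    z : V → ℕ
    z v = toℕ (proj₂ (proj₂ (pos v)))

    column-coordinates : ∀ {u v} → column u ≡ column v →
      proj₁ (pos u) ≡ proj₁ (pos v) × proj₁ (proj₂ (pos u)) ≡ proj₁ (proj₂ (pos v))
    column-coordinates = combine-injective _ _ _ _

    column-z-inj : ∀ {u v} → column u ≡ column v → z u ≡ z v → u ≡ v
    column-z-inj p q = let x≡ , y≡ = column-coordinates p in
      pos-inj (cong₂ _,_ x≡ (cong₂ _,_ y≡ (toℕ-injective q)))

    pt : V → Point
    pt v = toPoint (pos v)

    pt-≡ : ∀ {u k} v → column u ≡ column v → z u ≡ k → pt u ≡ (proj₁ (pt v) , proj₁ (proj₂ (pt v)) , + k)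
    pt-≡ v p q = let x≡ , y≡ = column-coordinates p in
      point-≡ (cong (+_ ∘ toℕ) x≡) (cong (+_ ∘ toℕ) y≡) (cong +_ q)

  -- A vertex strictly between the ends of a vertical edge would lie on that edge.
  column-edge-consecutive : ∀ {u v w} → Edge G v w → column u ≡ column v → column w ≡ column v →
                            z v < z u → z u < z w → ⊥
  column-edge-consecutive {u} {v} {w} e uv wv v<u u<w =
    go (vertsOK v w u e (s + r , s , <-≤-trans (m<n⇒0<n∸m v<u) (m≤m+n s r) , m≤m+n s r , on-segment))
    where
    s = z u ∸ z v
    r = z w ∸ z u
    zu : z u ≡ z v + s
    zu = sym (m+[n∸m]≡n (<⇒≤ v<u))
    zw : z w ≡ z v + s + r
    zw = sym (trans (cong (_+ r) (sym zu)) (m+[n∸m]≡n (<⇒≤ u<w)))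
    on-segment : (+ (s + r)) · pt u ≡ (+ 1) · combination (+ (s + r ∸ s)) (pt v) (+ s) (pt w)
    on-segment = begin
      (+ (s + r)) · pt u
        ≡⟨ cong ((+ (s + r)) ·_) (pt-≡ v uv zu) ⟩
      (+ (s + r)) · _
        ≡⟨ on-vertical-segment _ _ (+ z v) (+ s) (+ r) ⟩
      (+ 1) · combination (+ r) (pt v) (+ s) _
        ≡⟨ cong₂ (λ k P → (+ 1) · combination (+ k) (pt v) (+ s) P) (m+n∸m≡n s r) (pt-≡ v wv zw) ⟨
      (+ 1) · combination (+ (s + r ∸ s)) (pt v) (+ s) (pt w) ∎
      where open ≡-Reasoning
    go : u ≡ v ⊎ u ≡ w → ⊥
    go (inj₁ refl) = <-irrefl refl v<u
    go (inj₂ refl) = <-irrefl refl u<w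

  columns-cross : ∀ {v w x y} → Edge G v w → Edge G x y → column x ≡ column v → column w ≡ column y →
                  column v ≢ column y → z v < z x → z y < z w → ⊥
  columns-cross {v} {w} {x} {y} vw xy xv wy v≁y v<x y<w =
    let u , in-vw , in-xy , _ = edgesOK v w x y vw xy
           (λ { (refl , _) → <-irrefl refl v<x }) (λ { (refl , _) → v≁y refl })
           -- The diagonals divide each other in the ratio of the parallel sides `r` and `s`, whence
           -- the denominator `s + r` and the weight `r` of the second end.
           (s + r) _ 0<q
           (s + r , r , 0<q , m≤n+m r s , cong (λ k → (+ (s + r)) · combination (+ k) (pt v) (+ r) (pt w)) (sym (m+n∸n≡m s r)))
           (s + r , r , 0<q , m≤n+m r s , on-xy)
    in go in-vw in-xy
    where
    r = z x ∸ z v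
    s = z w ∸ z y
    0<q : 0 < s + r
    0<q = <-≤-trans (m<n⇒0<n∸m y<w) (m≤m+n s r)
    on-xy : (+ (s + r)) · combination (+ s) (pt v) (+ r) (pt w) ≡
            (+ (s + r)) · combination (+ (s + r ∸ r)) (pt x) (+ r) (pt y)
    on-xy = cong ((+ (s + r)) ·_) (begin
      combination (+ s) (pt v) (+ r) (pt w)
        ≡⟨ cong (combination (+ s) (pt v) (+ r)) (pt-≡ y wy (sym (m+[n∸m]≡n (<⇒≤ y<w)))) ⟩
      combination (+ s) (pt v) (+ r) _
        ≡⟨ crossing-point _ _ _ _ (+ z v) (+ z y) (+ r) (+ s) ⟩
      combination (+ s) _ (+ r) (pt y)
        ≡⟨ cong₂ (λ k P → combination (+ k) P (+ r) (pt y)) (m+n∸n≡m s r) (pt-≡ v xv (sym (m+[n∸m]≡n (<⇒≤ v<x)))) ⟨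
      combination (+ (s + r ∸ r)) (pt x) (+ r) (pt y) ∎)
      where open ≡-Reasoning
    go : ∀ {u} → u ≡ v ⊎ u ≡ w → u ≡ x ⊎ u ≡ y → ⊥
    go (inj₁ refl) (inj₁ refl) = <-irrefl refl v<x
    go (inj₁ refl) (inj₂ refl) = v≁y refl
    go (inj₂ refl) (inj₁ refl) = v≁y (trans (sym xv) wy)
    go (inj₂ refl) (inj₂ refl) = <-irrefl refl y<w

  drawing⇒track : TrackLayout G (2 * (A * B))
  drawing⇒track = record
    { track = track ; proper = proper ; rank = key ; rank-inj = key-inj ; noX = noX }
    where
    -- Vertex numbers only break ties between columns, because `rank` must be injective on all
    -- vertices.
    open Lex z toℕ toℕ-injective
    Below : V → V → Set
    Below v u = column u ≡ column v × z u < z v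
    below? : ∀ v u → Dec (Below v u)
    below? v u = (column u ≟ column v) ×-dec (z u <? z v)
    height : V → ℕ
    height v = count (λ u → does (below? v u))
    -- Nothing lies between the ends of a vertical edge, so the vertices below `w` are those below
    -- `v` together with `v`.
    height-edge : ∀ {v w} → Edge G v w → column v ≡ column w → z v < z w → height w ≡ suc (height v)
    height-edge {v} {w} e vw v<w = trans (sum-cong-≗ step′) (trans (sum-+-at _ v 1) (+-comm _ 1))
      where
      step′ : ∀ u → ind (does (below? w u)) ≡ ind (does (below? v u)) + at v 1 u
      step′ u with u ≟ v
      ... | yes refl
        rewrite dec-true (below? w v) (vw , v<w) | dec-false (below? v v) (<-irrefl refl ∘ proj₂) = refl
      ... | no u≢v = trans (cong ind (does-⇔ (mk⇔ to from) (below? w u) (below? v u))) (sym (+-identityʳ _))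
        where
        to : Below w u → Below v u
        to (uw , u<w) with <-cmp (z u) (z v)
        ... | tri< lt _ _ = trans uw (sym vw) , lt
        ... | tri≈ _ eq _ = contradiction (column-z-inj (trans uw (sym vw)) eq) u≢v
        ... | tri> _ _ gt = ⊥-elim (column-edge-consecutive e (trans uw (sym vw)) (sym vw) gt u<w)
        from : Below v u → Below w u
        from (uv , u<v) = trans uv vw , <-trans u<v v<w
    height-edge′ : ∀ {v w} → Edge G v w → column v ≡ column w →
                   height w ≡ suc (height v) ⊎ height v ≡ suc (height w)
    height-edge′ {v} {w} e vw with <-cmp (z v) (z w)
    ... | tri< lt _ _ = inj₁ (height-edge e vw lt)
    ... | tri> _ _ gt = inj₂ (height-edge (edge-sym G e) (sym vw) gt)
    ... | tri≈ _ eq _ with refl ← column-z-inj vw eq = contradiction e (edge-irr G)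
    height-mono : ∀ {v w} → column v ≡ column w → z v < z w → height v < height w
    height-mono {v} {w} vw v<w = begin
      suc (height v)                                        ≡⟨ trans (+-comm 1 _) (sym (sum-+-at _ v 1)) ⟩
      sum (λ u → ind (does (below? v u)) + at v 1 u)        ≤⟨ sum-mono-≤ step′ ⟩
      height w                                              ∎
      where
      open ≤-Reasoning
      step′ : ∀ u → ind (does (below? v u)) + at v 1 u ≤ ind (does (below? w u))
      step′ u with u ≟ v
      ... | yes refl
        rewrite dec-true (below? w v) (vw , v<w) | dec-false (below? v v) (<-irrefl refl ∘ proj₂) = ≤-refl
      ... | no _ = ≤-trans (≤-reflexive (+-identityʳ _)) (ind-mono (λ p →
              let uv , u<v = from-does (below? v u) p in dec-true (below? w u) (trans uv vw , <-trans u<v v<w)))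
    track : V → Fin (2 * (A * B))
    track v = combine (parity (height v)) (column v)
    track⁻ : ∀ {u v} → track u ≡ track v → parity (height u) ≡ parity (height v) × column u ≡ column v
    track⁻ {u} {v} = combine-injective (parity (height u)) (column u) (parity (height v)) (column v)
    proper : ∀ u v → Edge G u v → track u ≢ track v
    proper u v e eq with par , col ← track⁻ {u} {v} eq with height-edge′ e col
    ... | inj₁ p = parity-suc (height u) (trans par (cong parity p))
    ... | inj₂ p = parity-suc (height v) (trans (sym par) (cong parity p))
    key<⇒z< : ∀ {u v} → column u ≡ column v → key u < key v → z u < z v
    key<⇒z< col lt = ≤∧≢⇒< (key<⇒track≤ lt) λ eq → <-irrefl (cong key (column-z-inj col eq)) lt
    noX : ∀ v w x y → Edge G v w → Edge G x y → track v ≡ track x → track w ≡ track y →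
          key v < key x → key y < key w → ⊥
    noX v w x y vw xy eq₁ eq₂ v<x y<w with track⁻ {v} {x} eq₁ | track⁻ {w} {y} eq₂ | column v ≟ column y
    ... | _    , vx | _    , wy | no v≁y =
      columns-cross vw xy (sym vx) wy v≁y (key<⇒z< vx v<x) (key<⇒z< (sym wy) y<w)
    -- Both edges lie in one column. Heights of equal parity that differ do so by at least two,
    -- whereas the ends of a vertical edge differ by one, so `w` cannot be above `y`.
    ... | par₁ , vx | par₂ , wy | yes vy = <-irrefl refl (begin-strict
      height w             ≤⟨ step′ (height-edge′ vw (trans vy (sym wy))) ⟩
      suc (height v)       ≤⟨ ℕ.s<s⁻¹ (<-≤-trans (same-parity⇒gap par₁ (height-mono vx (key<⇒z< vx v<x)))
                                                (step′ (height-edge′ (edge-sym G xy) (trans (sym vy) vx)))) ⟩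
      height y             <⟨ height-mono (sym wy) (key<⇒z< (sym wy) y<w) ⟩
      height w             ∎)
      where
      open ≤-Reasoning
      step′ : ∀ {a b} → b ≡ suc a ⊎ a ≡ suc b → b ≤ suc a
      step′ (inj₁ refl) = ≤-refl
      step′ (inj₂ refl) = ≤-trans (n≤1+n _) (n≤1+n _)

-- Primes in polynomial intervals

-- The quotient is d ∫₀¹ xᵃ(1 - x)ᵇ dx, and xᵃ(1 - x)ᵇ⁺¹ = xᵃ(1 - x)ᵇ - xᵃ⁺¹(1 - x)ᵇ.
beta-integral : ∀ {d N} → (∀ i → suc i < N → suc i ∣ d) →
                ∀ a b → suc (a + b) < N → suc (a + b) ! ∣ d * (a ! * b !)
beta-integral {d} divs a zero lt rewrite +-identityʳ a | *-identityʳ (a !) = *-pres-∣ (divs a lt) ∣-refl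
beta-integral {d} divs a (suc b) lt rewrite +-suc a b =
  ∣m+n∣m⇒∣n (subst (suc (suc (a + b)) ! ∣_) (split d (a !) (b !) a b)
              (*-monoʳ-∣ (suc (suc (a + b))) (beta-integral divs a b (<-trans (n<1+n _) lt))))
            (beta-integral divs (suc a) b lt)
  where
  split : ∀ d x y a b → suc (suc (a + b)) * (d * (x * y)) ≡ d * (suc a * x * y) + d * (x * (suc b * y))
  split = solve-∀

2^m*m!*m!≤[1+2m]! : ∀ m → 2 ^ m * (m ! * m !) ≤ suc (m + m) !
2^m*m!*m!≤[1+2m]! zero = ≤-refl
2^m*m!*m!≤[1+2m]! (suc m) rewrite +-suc m m = begin
  2 * 2 ^ m * (suc m * m ! * (suc m * m !))             ≡⟨ rearrange (2 ^ m) (m !) m ⟩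
  suc m * (suc (suc (m + m)) * (2 ^ m * (m ! * m !)))   ≤⟨ *-mono-≤ (≤-trans (m≤m+n (suc m) m) (≤-trans (n≤1+n _) (n≤1+n _)))
                                                             (*-monoʳ-≤ (suc (suc (m + m))) (2^m*m!*m!≤[1+2m]! m)) ⟩
  suc (suc (suc (m + m))) * (suc (suc (m + m)) * suc (m + m) !)  ∎
  where
  open ≤-Reasoning
  rearrange : ∀ t f m → 2 * t * (suc m * f * (suc m * f)) ≡ suc m * (suc (suc (m + m)) * (t * (f * f)))
  rearrange = solve-∀

-- Nair's argument: `d` times the integral with both exponents `m` is a positive integer, while the
-- integral itself is at most the inverse of `2 ^ m`.
common-multiple-bound : ∀ {d} m → 1 ≤ d → (∀ i → suc i < 2 + (m + m) → suc i ∣ d) → 2 ^ m ≤ d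
common-multiple-bound {d} m 1≤d divs = *-cancelʳ-≤ (2 ^ m) d (m ! * m !) {{m !* m !≢0}} (begin
  2 ^ m * (m ! * m !)  ≤⟨ 2^m*m!*m!≤[1+2m]! m ⟩
  suc (m + m) !        ≤⟨ ∣⇒≤ {{>-nonZero (*-mono-≤ 1≤d (*-mono-≤ (1≤n! m) (1≤n! m)))}} (beta-integral divs m m ≤-refl) ⟩
  d * (m ! * m !)      ∎)
  where open ≤-Reasoning

n!≤n^n : ∀ n → n ! ≤ n ^ n
n!≤n^n zero    = ≤-refl
n!≤n^n (suc n) = *-monoʳ-≤ (suc n) (≤-trans (n!≤n^n n) (^-monoˡ-≤ n (n≤1+n n)))

-- Each prime is at least 2, so a product below `2 ^ K` has fewer than `K` factors, and each of them
-- divides its own copy of `M`.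
smooth-product∣ : ∀ {M} K {ps} → All Prime ps → (∀ {p} → Prime p → p < 2 ^ K → p ∣ M) →
                  product ps < 2 ^ K → product ps ∣ M ^ K
smooth-product∣ zero [] _ _ = 1∣ _
smooth-product∣ zero pps@(_ ∷ _) _ lt = contradiction lt (<⇒≱ (s≤s (productOfPrimes≥1 pps)))
smooth-product∣ (suc K) [] _ _ = 1∣ _
smooth-product∣ {M} (suc K) {p ∷ ps} (pp ∷ pps) small lt =
  *-pres-∣ (small pp (≤-<-trans (m≤m*n p (product ps) {{>-nonZero (productOfPrimes≥1 pps)}}) lt))
           (smooth-product∣ K pps (λ q q< → small q (<-≤-trans q< (m≤m+n (2 ^ K) _))) ps<)
  where
  ps< : product ps < 2 ^ K
  ps< = *-cancelˡ-< 2 _ _ (≤-<-trans (*-monoˡ-≤ (product ps) (nonTrivial⇒n>1 p {{prime⇒nonTrivial pp}})) lt)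

smooth∣ : ∀ {M} K → (∀ {p} → Prime p → p < 2 ^ K → p ∣ M) → ∀ i → suc i < 2 ^ K → suc i ∣ M ^ K
smooth∣ {M} K small i lt = subst (_∣ M ^ K) (sym isFactorisation)
  (smooth-product∣ K factorsPrime small (subst (_< 2 ^ K) isFactorisation lt))
  where open PrimeFactorisation (factorise (suc i))

-- If there were no such prime, (2 ^ s)! ^ (4 s + 1) would be a common multiple of
-- all numbers below 2 ^ (4 s + 1).
prime-between-powers : ∀ s → 1 ≤ s → ∃[ p ] (Prime p × 2 ^ s < p × p < 2 ^ suc (4 * s))
prime-between-powers s 1≤s
  with any? {n = 2 ^ suc (4 * s)} (λ i → prime? (toℕ i) ×-dec (2 ^ s <? toℕ i))
... | yes (i , pp , lt) = toℕ i , pp , lt , toℕ<n i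
... | no none = contradiction upper (<⇒≱ lower)
  where
  K = suc (4 * s)
  L = 2 ^ s
  m = 2 ^ (4 * s) ∸ 1
  suc-m : suc m ≡ 2 ^ (4 * s)
  suc-m = m+[n∸m]≡n (m^n>0 2 (4 * s))
  ∣L! : ∀ {p} → 1 ≤ p → p ≤ L → p ∣ L !
  ∣L! {suc p} _ le = ∣-trans (m∣m*n (p !)) (m≤n⇒m!∣n! le)
  small : ∀ {p} → Prime p → p < 2 ^ K → p ∣ L !
  small {p} pp lt = ∣L! (<⇒≤ (nonTrivial⇒n>1 p {{prime⇒nonTrivial pp}}))
    (≮⇒≥ (λ L<p → none (fromℕ< lt , subst Prime (sym (toℕ-fromℕ< lt)) pp , subst (L <_) (sym (toℕ-fromℕ< lt)) L<p)))
  range : 2 + (m + m) ≡ 2 ^ K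
  range = trans (double m) (cong (2 *_) suc-m)
    where
    double : ∀ m → 2 + (m + m) ≡ 2 * suc m
    double = solve-∀
  divs : ∀ i → suc i < 2 + (m + m) → suc i ∣ (L !) ^ K
  divs i lt = smooth∣ K small i (subst (suc i <_) range lt)
  upper : 2 ^ m ≤ 2 ^ (s * L * K)
  upper = begin
    2 ^ m              ≤⟨ common-multiple-bound m (m^n>0 (L !) {{L !≢0}} K) divs ⟩
    (L !) ^ K          ≤⟨ ^-monoˡ-≤ K (n!≤n^n L) ⟩
    (L ^ L) ^ K        ≡⟨ cong (_^ K) (^-*-assoc 2 s L) ⟩
    (2 ^ (s * L)) ^ K  ≡⟨ ^-*-assoc 2 (s * L) K ⟩
    2 ^ (s * L * K)    ∎
    where open ≤-Reasoning
  -- The goal is `s * L * K < 2 ^ (4 * s) ∸ 1`. Splitting off `L = 2 ^ s` leaves `8 ^ s` to absorb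
  -- the quadratic factor.
  8^s : ∀ s → suc (s * suc (4 * s)) ≤ 8 ^ s
  8^s zero    = ≤-refl
  8^s (suc s) = begin
    suc (suc s * suc (4 * suc s))                                  ≡⟨ expand s ⟩
    4 * (s * s) + s + 8 * s + 6                                    ≤⟨ +-mono-≤ (+-monoˡ-≤ (8 * s) (+-mono-≤ (*-monoʳ-≤ 4 (≤-refl {s * s})) (s≤s*s*4 s))) (m≤m+n 6 (24 * (s * s) + 2)) ⟩
    4 * (s * s) + 4 * (s * s) + 8 * s + (6 + (24 * (s * s) + 2))   ≡⟨ collect s ⟩
    8 * suc (s * suc (4 * s))                                      ≤⟨ *-monoʳ-≤ 8 (8^s s) ⟩
    8 * 8 ^ s                                                      ∎
    where
    open ≤-Reasoning
    expand : ∀ s → suc (suc s * suc (4 * suc s)) ≡ 4 * (s * s) + s + 8 * s + 6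
    expand = solve-∀
    collect : ∀ s → 4 * (s * s) + 4 * (s * s) + 8 * s + (6 + (24 * (s * s) + 2)) ≡ 8 * suc (s * suc (4 * s))
    collect = solve-∀
    s≤s*s*4 : ∀ s → s ≤ 4 * (s * s)
    s≤s*s*4 zero        = z≤n
    s≤s*s*4 s@(suc _) = ≤-trans (m≤m*n s s) (m≤n*m (s * s) 4)
  lower : 2 ^ (s * L * K) < 2 ^ m
  lower = ^-monoʳ-< 2 ≤-refl (ℕ.s<s⁻¹ (begin-strict
    suc (s * L * K)           <⟨ n<1+n _ ⟩
    -- Here `1 ≤ s` supplies `2 ≤ L`, the slack for the 1 subtracted in `m`.
    2 + s * L * K             ≤⟨ +-monoˡ-≤ (s * L * K) (^-monoʳ-≤ 2 1≤s) ⟩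
    L + s * L * K             ≡⟨ factor L s ⟩
    L * suc (s * suc (4 * s)) ≤⟨ *-monoʳ-≤ L (8^s s) ⟩
    L * 8 ^ s                 ≡⟨ cong (L *_) (^-*-assoc 2 3 s) ⟩
    2 ^ s * 2 ^ (3 * s)       ≡⟨ ^-distribˡ-+-* 2 s (3 * s) ⟨
    2 ^ (4 * s)               ≡⟨ suc-m ⟨
    suc m                     ∎))
    where
    open ≤-Reasoning
    factor : ∀ L s → L + s * L * suc (4 * s) ≡ L * suc (s * suc (4 * s))
    factor = solve-∀

power-of-2-between : ∀ t → ∃[ s ] (suc t ≤ 2 ^ s × 2 ^ s ≤ 2 * suc t)
power-of-2-between zero = 0 , ≤-refl , n≤1+n 1
power-of-2-between (suc t) with s , lo , hi ← power-of-2-between t with 2 + t ≤? 2 ^ s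
... | yes le = s , le , ≤-trans hi (*-monoʳ-≤ 2 (n≤1+n (suc t)))
... | no nle = suc s , ≤-trans (+-monoˡ-≤ (suc t) (s≤s (z≤n {t}))) (≤-trans (+-mono-≤ lo lo) (≤-reflexive (cong (λ x → 2 ^ s + x) (sym (+-identityʳ _)))))
             , *-monoʳ-≤ 2 (<⇒≤ (≰⇒> nle))

-- A power of two between `2 * t` and `4 * t` lies below the prime, and twice its fourth power
-- above; the constant is `2 * 4 ^ 4`.
prime-above : ∀ t → 1 ≤ t → ∃[ p ] (Prime p × 2 * t ≤ p × p ≤ 512 * t ^ 4)
prime-above (suc t) _ with s , lo , hi ← power-of-2-between t
                      with p , pp , L<p , p< ← prime-between-powers (suc s) (s≤s z≤n) =
  p , pp , ≤-trans (*-monoʳ-≤ 2 lo) (<⇒≤ L<p) , (begin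
    p                                ≤⟨ <⇒≤ p< ⟩
    2 * 2 ^ (4 * suc s)              ≡⟨ cong (λ e → 2 * 2 ^ e) (*-comm 4 (suc s)) ⟩
    2 * 2 ^ (suc s * 4)              ≡⟨ cong (2 *_) (^-*-assoc 2 (suc s) 4) ⟨
    2 * (2 * 2 ^ s) ^ 4              ≤⟨ *-monoʳ-≤ 2 (^-monoˡ-≤ 4 (*-monoʳ-≤ 2 hi)) ⟩
    2 * (2 * (2 * suc t)) ^ 4        ≡⟨ expand (suc t) ⟩
    512 * suc t ^ 4                  ∎)
  where
  open ≤-Reasoning
  expand : ∀ t → 2 * ((2 * (2 * t)) * ((2 * (2 * t)) * ((2 * (2 * t)) * ((2 * (2 * t)) * 1)))) ≡ 512 * (t * (t * (t * (t * 1))))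
  expand = solve-∀

-- Affine independence of points (t² , t³ , z) with z ≡ t modulo a prime

*ᶻ-cancelʳ-0 : ∀ x {y} → y ≢ 0ℤ → x *ᶻ y ≡ 0ℤ → x ≡ 0ℤ
*ᶻ-cancelʳ-0 x y≢0 eq = [ id , (λ y≡0 → contradiction y≡0 y≢0) ]′ (ℤ.i*j≡0⇒i≡0∨j≡0 x eq)

+-−-≢0 : ∀ {a b} → a ≢ b → + a -ᶻ + b ≢ 0ℤ
+-−-≢0 a≢b eq = a≢b (ℤ.+-injective (ℤ.i-j≡0⇒i≡j _ _ eq))

vanish₂ : ∀ {s t} x y → s ≡ 0ℤ → t ≡ 0ℤ → x *ᶻ s +ᶻ y *ᶻ t ≡ 0ℤ
vanish₂ x y refl refl = cong₂ _+ᶻ_ (ℤ.*-zeroʳ x) (ℤ.*-zeroʳ y)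

vanish₃ : ∀ {s t u} x y z → s ≡ 0ℤ → t ≡ 0ℤ → u ≡ 0ℤ → x *ᶻ s +ᶻ y *ᶻ t +ᶻ z *ᶻ u ≡ 0ℤ
vanish₃ x y z p q refl = cong₂ _+ᶻ_ (vanish₂ x y p q) (ℤ.*-zeroʳ z)

-- In the following lemmas the cⱼ are weights on the points (t² , t³) of a curve,
-- one weight for each parameter t in a, b, e, g.

-- Apply the weights to t² - b², which vanishes at `b`. At `a` its factor a + b is nonzero, the
-- parameters being distinct natural numbers.
moments₂ : ∀ {a b : ℕ} → a ≢ b → ∀ c₁ c₂ → c₁ +ᶻ c₂ ≡ 0ℤ →
           c₁ *ᶻ (+ a *ᶻ + a) +ᶻ c₂ *ᶻ (+ b *ᶻ + b) ≡ 0ℤ → c₁ ≡ 0ℤ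
moments₂ {a} {b} a≢b c₁ c₂ s₀ s₂ =
  *ᶻ-cancelʳ-0 c₁ (+-−-≢0 a≢b) (*ᶻ-cancelʳ-0 (c₁ *ᶻ (+ a -ᶻ + b)) a+b≢0
    (trans (identity (+ a) (+ b) c₁ c₂) (vanish₂ ℤ.1ℤ (-ᶻ (+ b *ᶻ + b)) s₂ s₀)))
  where
  a+b≢0 : + a +ᶻ + b ≢ 0ℤ
  a+b≢0 eq = a≢b (trans (m+n≡0⇒m≡0 a (ℤ.+-injective eq)) (sym (m+n≡0⇒n≡0 a (ℤ.+-injective eq))))
  identity : ∀ a b c₁ c₂ → c₁ *ᶻ (a -ᶻ b) *ᶻ (a +ᶻ b) ≡
             ℤ.1ℤ *ᶻ (c₁ *ᶻ (a *ᶻ a) +ᶻ c₂ *ᶻ (b *ᶻ b)) +ᶻ (-ᶻ (b *ᶻ b)) *ᶻ (c₁ +ᶻ c₂)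
  identity = ℤ-Solver.solve-∀

-- The cubic (t - b)(t - e)((b + e)t + be) has no linear term.
moments₃ : ∀ {a b e : ℕ} → a ≢ b → a ≢ e → b ≢ e → ∀ c₁ c₂ c₃ → c₁ +ᶻ c₂ +ᶻ c₃ ≡ 0ℤ →
  c₁ *ᶻ (+ a *ᶻ + a) +ᶻ c₂ *ᶻ (+ b *ᶻ + b) +ᶻ c₃ *ᶻ (+ e *ᶻ + e) ≡ 0ℤ →
  c₁ *ᶻ (+ a *ᶻ + a *ᶻ + a) +ᶻ c₂ *ᶻ (+ b *ᶻ + b *ᶻ + b) +ᶻ c₃ *ᶻ (+ e *ᶻ + e *ᶻ + e) ≡ 0ℤ → c₁ ≡ 0ℤ
moments₃ {a} {b} {e} a≢b a≢e b≢e c₁ c₂ c₃ s₀ s₂ s₃ =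
  *ᶻ-cancelʳ-0 _ (+-−-≢0 a≢b) (*ᶻ-cancelʳ-0 _ (+-−-≢0 a≢e) (*ᶻ-cancelʳ-0 _ σ≢0
    (trans (identity (+ a) (+ b) (+ e) c₁ c₂ c₃) (vanish₃ (B +ᶻ E) (B *ᶻ E -ᶻ (B +ᶻ E) *ᶻ (B +ᶻ E)) (B *ᶻ B *ᶻ E *ᶻ E) s₃ s₂ s₀))))
  where
  B = + b
  E = + e
  -- This is the last factor of the cubic at t = a; it could vanish only if two of the three
  -- parameters were zero.
  nat-σ≢0 : a * b + a * e + b * e ≢ 0
  nat-σ≢0 eq with m*n≡0⇒m≡0∨n≡0 a (m+n≡0⇒m≡0 (a * b) (m+n≡0⇒m≡0 (a * b + a * e) eq))
                | m*n≡0⇒m≡0∨n≡0 a (m+n≡0⇒n≡0 (a * b) (m+n≡0⇒m≡0 (a * b + a * e) eq))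
                | m*n≡0⇒m≡0∨n≡0 b (m+n≡0⇒n≡0 (a * b + a * e) eq)
  ... | inj₁ p | _      | inj₁ q = a≢b (trans p (sym q))
  ... | inj₁ p | _      | inj₂ q = a≢e (trans p (sym q))
  ... | inj₂ p | inj₁ q | _      = a≢b (trans q (sym p))
  ... | inj₂ p | inj₂ q | _      = b≢e (trans p (sym q))
  σ≢0 : + a *ᶻ B +ᶻ + a *ᶻ E +ᶻ B *ᶻ E ≢ 0ℤ
  σ≢0 eq = nat-σ≢0 (ℤ.+-injective (trans (cong₂ _+ᶻ_ (cong₂ _+ᶻ_ (ℤ.pos-* a b) (ℤ.pos-* a e)) (ℤ.pos-* b e)) eq))
  identity : ∀ a b e c₁ c₂ c₃ →
    c₁ *ᶻ (a -ᶻ b) *ᶻ (a -ᶻ e) *ᶻ (a *ᶻ b +ᶻ a *ᶻ e +ᶻ b *ᶻ e) ≡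
    (b +ᶻ e) *ᶻ (c₁ *ᶻ (a *ᶻ a *ᶻ a) +ᶻ c₂ *ᶻ (b *ᶻ b *ᶻ b) +ᶻ c₃ *ᶻ (e *ᶻ e *ᶻ e)) +ᶻ
    (b *ᶻ e -ᶻ (b +ᶻ e) *ᶻ (b +ᶻ e)) *ᶻ (c₁ *ᶻ (a *ᶻ a) +ᶻ c₂ *ᶻ (b *ᶻ b) +ᶻ c₃ *ᶻ (e *ᶻ e)) +ᶻ
    b *ᶻ b *ᶻ e *ᶻ e *ᶻ (c₁ +ᶻ c₂ +ᶻ c₃)
  identity = ℤ-Solver.solve-∀

Weighted : (c₁ c₂ c₃ c₄ f₁ f₂ f₃ f₄ : ℤ) → ℤ
Weighted c₁ c₂ c₃ c₄ f₁ f₂ f₃ f₄ = c₁ *ᶻ f₁ +ᶻ c₂ *ᶻ f₂ +ᶻ c₃ *ᶻ f₃ +ᶻ c₄ *ᶻ f₄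

Weighted-rotate : ∀ c₁ c₂ c₃ c₄ f₁ f₂ f₃ f₄ →
  Weighted c₁ c₂ c₃ c₄ f₁ f₂ f₃ f₄ ≡ 0ℤ → Weighted c₂ c₃ c₄ c₁ f₂ f₃ f₄ f₁ ≡ 0ℤ
Weighted-rotate c₁ c₂ c₃ c₄ f₁ f₂ f₃ f₄ = trans (rotate c₁ c₂ c₃ c₄ f₁ f₂ f₃ f₄)
  where
  rotate : ∀ c₁ c₂ c₃ c₄ f₁ f₂ f₃ f₄ → c₂ *ᶻ f₂ +ᶻ c₃ *ᶻ f₃ +ᶻ c₄ *ᶻ f₄ +ᶻ c₁ *ᶻ f₁ ≡ c₁ *ᶻ f₁ +ᶻ c₂ *ᶻ f₂ +ᶻ c₃ *ᶻ f₃ +ᶻ c₄ *ᶻ f₄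
  rotate = ℤ-Solver.solve-∀

Weighted-unscale : ∀ {p} → p ≢ 0ℤ → ∀ c₁ c₂ c₃ c₄ f₁ f₂ f₃ f₄ →
  Weighted (c₁ *ᶻ p) (c₂ *ᶻ p) (c₃ *ᶻ p) (c₄ *ᶻ p) f₁ f₂ f₃ f₄ ≡ 0ℤ → Weighted c₁ c₂ c₃ c₄ f₁ f₂ f₃ f₄ ≡ 0ℤ
Weighted-unscale {p} p≢0 c₁ c₂ c₃ c₄ f₁ f₂ f₃ f₄ eq = *ᶻ-cancelʳ-0 _ p≢0 (trans (scale p c₁ c₂ c₃ c₄ f₁ f₂ f₃ f₄) eq)
  where
  scale : ∀ p c₁ c₂ c₃ c₄ f₁ f₂ f₃ f₄ → (c₁ *ᶻ f₁ +ᶻ c₂ *ᶻ f₂ +ᶻ c₃ *ᶻ f₃ +ᶻ c₄ *ᶻ f₄) *ᶻ p ≡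
    c₁ *ᶻ p *ᶻ f₁ +ᶻ c₂ *ᶻ p *ᶻ f₂ +ᶻ c₃ *ᶻ p *ᶻ f₃ +ᶻ c₄ *ᶻ p *ᶻ f₄
  scale = ℤ-Solver.solve-∀

module _ {p : ℕ} (pp : Prime p) where

  private
    P = + p

    _≁_ : ℤ → ℤ → Set
    a ≁ b = ¬ P ∣ᶻ (a -ᶻ b)

  -- Nonzero weights of this kind exist exactly when the four points (t² , t³ , t + p k) are
  -- coplanar; `s₀` makes the dependence affine.
  record Dependent (a b e g ka kb ke kg c₁ c₂ c₃ c₄ : ℤ) : Set where
    field
      s₀ : Weighted c₁ c₂ c₃ c₄ ℤ.1ℤ ℤ.1ℤ ℤ.1ℤ ℤ.1ℤ ≡ 0ℤ
      s₂ : Weighted c₁ c₂ c₃ c₄ (a *ᶻ a) (b *ᶻ b) (e *ᶻ e) (g *ᶻ g) ≡ 0ℤ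
      s₃ : Weighted c₁ c₂ c₃ c₄ (a *ᶻ a *ᶻ a) (b *ᶻ b *ᶻ b) (e *ᶻ e *ᶻ e) (g *ᶻ g *ᶻ g) ≡ 0ℤ
      sz : Weighted c₁ c₂ c₃ c₄ (a +ᶻ P *ᶻ ka) (b +ᶻ P *ᶻ kb) (e +ᶻ P *ᶻ ke) (g +ᶻ P *ᶻ kg) ≡ 0ℤ

  Dependent-rotate : ∀ {a b e g ka kb ke kg c₁ c₂ c₃ c₄} →
    Dependent a b e g ka kb ke kg c₁ c₂ c₃ c₄ → Dependent b e g a kb ke kg ka c₂ c₃ c₄ c₁
  Dependent-rotate {c₁ = c₁} {c₂} {c₃} {c₄} D = record { s₀ = rot s₀ ; s₂ = rot s₂ ; s₃ = rot s₃ ; sz = rot sz }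
    where
    open Dependent D
    rot : ∀ {f₁ f₂ f₃ f₄} → Weighted c₁ c₂ c₃ c₄ f₁ f₂ f₃ f₄ ≡ 0ℤ → Weighted c₂ c₃ c₄ c₁ f₂ f₃ f₄ f₁ ≡ 0ℤ
    rot = Weighted-rotate c₁ c₂ c₃ c₄ _ _ _ _

  euclidᶻ : ∀ {x y} → P ∣ᶻ x *ᶻ y → ¬ P ∣ᶻ y → P ∣ᶻ x
  euclidᶻ {x} {y} div ndiv with euclidsLemma ∣ x ∣ ∣ y ∣ pp (subst (p ℕ.∣_) (ℤ.abs-* x y) (∣ᶻ⇒∣ div))
  ... | inj₁ q = ∣⇒∣ᶻ q
  ... | inj₂ q = contradiction (∣⇒∣ᶻ q) ndiv

  -- Apply the functional f ↦ Σ cⱼ f(tⱼ) to (t - b)(t - e)(t - g): it kills 1, t², t³,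
  -- and t up to a multiple of p.
  p∣weight : ∀ {a b e g ka kb ke kg c₁ c₂ c₃ c₄} → a ≁ b → a ≁ e → a ≁ g →
             Dependent a b e g ka kb ke kg c₁ c₂ c₃ c₄ → P ∣ᶻ c₁
  p∣weight {a} {b} {e} {g} {ka} {kb} {ke} {kg} {c₁} {c₂} {c₃} {c₄} a≁b a≁e a≁g D =
    euclidᶻ (euclidᶻ (euclidᶻ {c₁ *ᶻ (a -ᶻ b) *ᶻ (a -ᶻ e)} (divides q eq) a≁g) a≁e) a≁b
    where
    open Dependent D
    K = Weighted c₁ c₂ c₃ c₄ ka kb ke kg
    σ₁ = b +ᶻ e +ᶻ g
    σ₂ = b *ᶻ e +ᶻ b *ᶻ g +ᶻ e *ᶻ g
    q = -ᶻ (σ₂ *ᶻ K)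
    linear : ∀ P ka kb ke kg a b e g c₁ c₂ c₃ c₄ →
      c₁ *ᶻ a +ᶻ c₂ *ᶻ b +ᶻ c₃ *ᶻ e +ᶻ c₄ *ᶻ g ≡
      (c₁ *ᶻ (a +ᶻ P *ᶻ ka) +ᶻ c₂ *ᶻ (b +ᶻ P *ᶻ kb) +ᶻ c₃ *ᶻ (e +ᶻ P *ᶻ ke) +ᶻ c₄ *ᶻ (g +ᶻ P *ᶻ kg)) -ᶻ
      (c₁ *ᶻ ka +ᶻ c₂ *ᶻ kb +ᶻ c₃ *ᶻ ke +ᶻ c₄ *ᶻ kg) *ᶻ P
    linear = ℤ-Solver.solve-∀
    cubic : ∀ a b e g c₁ c₂ c₃ c₄ → c₁ *ᶻ (a -ᶻ b) *ᶻ (a -ᶻ e) *ᶻ (a -ᶻ g) ≡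
      (ℤ.1ℤ *ᶻ (c₁ *ᶻ (a *ᶻ a *ᶻ a) +ᶻ c₂ *ᶻ (b *ᶻ b *ᶻ b) +ᶻ c₃ *ᶻ (e *ᶻ e *ᶻ e) +ᶻ c₄ *ᶻ (g *ᶻ g *ᶻ g)) +ᶻ
      (-ᶻ (b +ᶻ e +ᶻ g)) *ᶻ (c₁ *ᶻ (a *ᶻ a) +ᶻ c₂ *ᶻ (b *ᶻ b) +ᶻ c₃ *ᶻ (e *ᶻ e) +ᶻ c₄ *ᶻ (g *ᶻ g)) +ᶻ
      (-ᶻ (b *ᶻ e *ᶻ g)) *ᶻ (c₁ *ᶻ ℤ.1ℤ +ᶻ c₂ *ᶻ ℤ.1ℤ +ᶻ c₃ *ᶻ ℤ.1ℤ +ᶻ c₄ *ᶻ ℤ.1ℤ)) +ᶻ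
      (b *ᶻ e +ᶻ b *ᶻ g +ᶻ e *ᶻ g) *ᶻ (c₁ *ᶻ a +ᶻ c₂ *ᶻ b +ᶻ c₃ *ᶻ e +ᶻ c₄ *ᶻ g)
    cubic = ℤ-Solver.solve-∀
    tidy : ∀ σ K P → 0ℤ +ᶻ σ *ᶻ (0ℤ -ᶻ K *ᶻ P) ≡ (-ᶻ (σ *ᶻ K)) *ᶻ P
    tidy = ℤ-Solver.solve-∀
    eq : c₁ *ᶻ (a -ᶻ b) *ᶻ (a -ᶻ e) *ᶻ (a -ᶻ g) ≡ q *ᶻ P
    eq = trans (cubic a b e g c₁ c₂ c₃ c₄)
         (trans (cong₂ (λ s t → s +ᶻ σ₂ *ᶻ t)
                  (vanish₃ ℤ.1ℤ (-ᶻ σ₁) (-ᶻ (b *ᶻ e *ᶻ g)) s₃ s₂ s₀)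
                  (trans (linear P ka kb ke kg a b e g c₁ c₂ c₃ c₄) (cong (_-ᶻ K *ᶻ P) sz)))
                (tidy σ₂ K P))

  private
    P≢0 : P ≢ 0ℤ
    P≢0 eq = ℕ.≢-nonZero⁻¹ p {{prime⇒nonZero pp}} (ℤ.+-injective eq)

  Dependent-unscale : ∀ {a b e g ka kb ke kg c₁ c₂ c₃ c₄ q₁ q₂ q₃ q₄} →
    c₁ ≡ q₁ *ᶻ P → c₂ ≡ q₂ *ᶻ P → c₃ ≡ q₃ *ᶻ P → c₄ ≡ q₄ *ᶻ P →
    Dependent a b e g ka kb ke kg c₁ c₂ c₃ c₄ → Dependent a b e g ka kb ke kg q₁ q₂ q₃ q₄
  Dependent-unscale {a} {b} {e} {g} {ka} {kb} {ke} {kg} {q₁ = q₁} {q₂} {q₃} {q₄} refl refl refl refl D = record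
    { s₀ = unscale ℤ.1ℤ ℤ.1ℤ ℤ.1ℤ ℤ.1ℤ s₀
    ; s₂ = unscale (a *ᶻ a) (b *ᶻ b) (e *ᶻ e) (g *ᶻ g) s₂
    ; s₃ = unscale (a *ᶻ a *ᶻ a) (b *ᶻ b *ᶻ b) (e *ᶻ e *ᶻ e) (g *ᶻ g *ᶻ g) s₃
    ; sz = unscale (a +ᶻ P *ᶻ ka) (b +ᶻ P *ᶻ kb) (e +ᶻ P *ᶻ ke) (g +ᶻ P *ᶻ kg) sz }
    where
    open Dependent D
    unscale = Weighted-unscale P≢0 q₁ q₂ q₃ q₄

  module _ {a b e g : ℤ} (ab : a ≁ b) (ae : a ≁ e) (ag : a ≁ g) (be : b ≁ e) (bg : b ≁ g) (eg : e ≁ g)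
           (ka kb ke kg : ℤ) where

    private
      ≁-sym : ∀ x y → x ≁ y → y ≁ x
      ≁-sym x y n d = n (∣⇒∣ᶻ (subst (p ℕ.∣_) (ℤ.∣i-j∣≡∣j-i∣ y x) (∣ᶻ⇒∣ d)))

    -- Infinite descent: by rotation `p` divides all four weights, and the quotients form a
    -- dependence again. The fuel `N` bounds the first weight, which shrinks unless it is zero.
    independent-fuel : ∀ N c₁ c₂ c₃ c₄ → ∣ c₁ ∣ ≤ N → Dependent a b e g ka kb ke kg c₁ c₂ c₃ c₄ → c₁ ≡ 0ℤ
    independent-fuel zero    c₁ _  _  _  le D = ℤ.∣i∣≡0⇒i≡0 (n≤0⇒n≡0 le)
    independent-fuel (suc N) c₁ c₂ c₃ c₄ le D = descend
      (p∣weight ab ae ag D)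
      (p∣weight be bg (≁-sym a b ab) D₂)
      (p∣weight eg (≁-sym a e ae) (≁-sym b e be) D₃)
      (p∣weight (≁-sym a g ag) (≁-sym b g bg) (≁-sym e g eg) (Dependent-rotate D₃))
      where
      D₂ = Dependent-rotate D
      D₃ = Dependent-rotate D₂
      descend : P ∣ᶻ c₁ → P ∣ᶻ c₂ → P ∣ᶻ c₃ → P ∣ᶻ c₄ → c₁ ≡ 0ℤ
      descend (divides q₁ e₁) (divides q₂ e₂) (divides q₃ e₃) (divides q₄ e₄) =
        trans e₁ (cong (_*ᶻ P) (independent-fuel N q₁ q₂ q₃ q₄ smaller (Dependent-unscale e₁ e₂ e₃ e₄ D)))
        where
        q*p≤ : ∣ q₁ ∣ * p ≤ suc N
        q*p≤ = subst (_≤ suc N) (trans (cong ∣_∣ e₁) (ℤ.abs-* q₁ P)) le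
        shrink : ∀ q → q * p ≤ suc N → q ≤ N
        shrink zero    _   = z≤n
        shrink (suc q) le′ = ℕ.s≤s⁻¹ (≤-trans (m<m*n (suc q) p (ℕ.nonTrivial⇒n>1 p {{prime⇒nonTrivial pp}})) le′)
        smaller : ∣ q₁ ∣ ≤ N
        smaller = shrink ∣ q₁ ∣ q*p≤

    independent : ∀ c₁ c₂ c₃ c₄ → Dependent a b e g ka kb ke kg c₁ c₂ c₃ c₄ → c₁ ≡ 0ℤ
    independent c₁ c₂ c₃ c₄ = independent-fuel ∣ c₁ ∣ c₁ c₂ c₃ c₄ ≤-refl

  private
    ∤-difference : ∀ {a b} → a < b → b < p → ¬ p ℕ.∣ ∣ + b -ᶻ + a ∣
    ∤-difference {a} {b} a<b b<p d = <⇒≱ (≤-<-trans (m∸n≤m b a) b<p)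
      (ℕ.∣⇒≤ {{ℕ.>-nonZero (m<n⇒0<n∸m a<b)}} (subst (p ℕ.∣_) (cong ∣_∣ (trans (ℤ.[+m]-[+n]≡m⊖n b a) (ℤ.⊖-≥ (<⇒≤ a<b)))) d))

  distinct-residues : ∀ {a b} → a < p → b < p → a ≢ b → (+ a) ≁ (+ b)
  distinct-residues {a} {b} a<p b<p a≢b div with <-cmp a b
  ... | tri< a<b _ _ = ∤-difference a<b b<p (subst (p ℕ.∣_) (ℤ.∣i-j∣≡∣j-i∣ (+ a) (+ b)) (∣ᶻ⇒∣ div))
  ... | tri≈ _ eq _  = a≢b eq
  ... | tri> _ _ b<a = ∤-difference b<a a<p (∣ᶻ⇒∣ div)

-- Drawings from track layouts

-- Giving both ends weights of their own, in place of a truncated difference, makes them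
-- interchangeable.
record Between (d : ℕ) (P A B : Point) : Set where
  field
    r s      : ℕ
    positive : 0 < r + s
    equation : (+ (r + s)) · P ≡ (+ d) · combination (+ r) A (+ s) B

OnSeg⇒Between : ∀ {d P A B} → OnSeg d P A B → Between d P A B
OnSeg⇒Between {d} {P} {A} {B} (q , s , 0<q , s≤q , eq) = record
  { r = q ∸ s ; s = s
  ; positive = subst (0 <_) (sym (m∸n+n≡m s≤q)) 0<q
  ; equation = trans (cong (λ q → (+ q) · P) (m∸n+n≡m s≤q)) eq }

combination-comm : ∀ r P s Q → combination r P s Q ≡ combination s Q r P
combination-comm r (x , y , z) s (x′ , y′ , z′) =
  point-≡ (ℤ.+-comm (r *ᶻ x) (s *ᶻ x′)) (ℤ.+-comm (r *ᶻ y) (s *ᶻ y′)) (ℤ.+-comm (r *ᶻ z) (s *ᶻ z′))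

Between-sym : ∀ {d P A B} → Between d P A B → Between d P B A
Between-sym {d} {P} {A} {B} b = record
  { r = s ; s = r ; positive = subst (0 <_) (+-comm r s) positive
  ; equation = trans (cong (λ q → (+ q) · P) (+-comm s r))
               (trans equation (cong ((+ d) ·_) (combination-comm (+ r) A (+ s) B))) }
  where open Between b

·-cancel : ∀ {k P Q} → 0 < k → (+ k) · P ≡ (+ k) · Q → P ≡ Q
·-cancel {suc k} {x , y , z} {x′ , y′ , z′} _ eq = point-≡
  (ℤ.*-cancelˡ-≡ (+ suc k) x x′ (cong proj₁ eq))
  (ℤ.*-cancelˡ-≡ (+ suc k) y y′ (cong (proj₁ ∘ proj₂) eq))
  (ℤ.*-cancelˡ-≡ (+ suc k) z z′ (cong (proj₂ ∘ proj₂) eq))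

Between-end : ∀ {d P A B} (b : Between d P A B) → Between.s b ≡ 0 → P ≡ (+ d) · A
Between-end {d} {P} {A} {B} b refl = ·-cancel positive (trans equation (at-end (+ d) (+ r) A B (ℤ.pos-+ r 0)))
  where
  open Between b
  coordinate : ∀ d r a b → d *ᶻ (r *ᶻ a +ᶻ 0ℤ *ᶻ b) ≡ r *ᶻ (d *ᶻ a)
  coordinate = ℤ-Solver.solve-∀
  at-end : ∀ d r A B {r′} → r′ ≡ r +ᶻ 0ℤ → d · combination r A 0ℤ B ≡ r′ · (d · A)
  at-end d r (x , y , z) (x′ , y′ , z′) refl rewrite ℤ.+-identityʳ r =
    point-≡ (coordinate d r x x′) (coordinate d r y y′) (coordinate d r z z′)

-- Homogeneous barycentric coordinates of a common point of the segments AB and A′B′.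
record Meeting (A B A′ B′ : Point) : Set where
  field
    α β γ δ  : ℕ
    total    : α + β ≡ γ + δ
    positive : 0 < α + β
    equation : combination (+ α) A (+ β) B ≡ combination (+ γ) A′ (+ δ) B′

-- Both descriptions of `P` are brought to the denominator `q * q′`. The two implications carry a
-- vanishing weight back to `b`.
meeting : ∀ {d P A B A′ B′} → 0 < d → (b : Between d P A B) (b′ : Between d P A′ B′) →
  Σ (Meeting A B A′ B′) λ M → (Meeting.β M ≡ 0 → Between.s b ≡ 0) × (Meeting.α M ≡ 0 → Between.r b ≡ 0)
meeting {d} {P} {A} {B} {A′} {B′} 0<d b b′ =
  record { α = q′ * r ; β = q′ * s ; γ = q * r′ ; δ = q * s′
         ; total = trans (sym (*-distribˡ-+ q′ r s)) (trans (*-comm q′ q) (*-distribˡ-+ q r′ s′))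
         ; positive = subst (0 <_) (*-distribˡ-+ q′ r s) (*-mono-≤ b′.positive b.positive)
         ; equation = ·-cancel 0<d (trans (outer q q′ (+ d) (+ r) (+ s) (ℤ.pos-* q′ r) (ℤ.pos-* q′ s) A B P b.equation)
                        (trans (swap-scales (+ q′) (+ q) P) (sym (outer q′ q (+ d) (+ r′) (+ s′) (ℤ.pos-* q r′) (ℤ.pos-* q s′) A′ B′ P b′.equation)))) }
  , zero-factor s , zero-factor r
  where
  module b = Between b
  module b′ = Between b′
  open b using (r; s)
  open b′ using () renaming (r to r′; s to s′)
  q = r + s
  q′ = r′ + s′
  zero-factor : ∀ x → q′ * x ≡ 0 → x ≡ 0
  zero-factor x eq = [ (λ q′≡0 → contradiction b′.positive (<-irrefl (sym q′≡0))) , id ]′ (m*n≡0⇒m≡0∨n≡0 q′ eq)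
  swap-scales : ∀ k l P → k · (l · P) ≡ l · (k · P)
  swap-scales k l (x , y , z) = point-≡ (c k l x) (c k l y) (c k l z)
    where
    c : ∀ k l x → k *ᶻ (l *ᶻ x) ≡ l *ᶻ (k *ᶻ x)
    c = ℤ-Solver.solve-∀
  outer : ∀ q q′ d r s {x y} → x ≡ + q′ *ᶻ r → y ≡ + q′ *ᶻ s → ∀ A B P →
          (+ q) · P ≡ d · combination r A s B →
          d · combination x A y B ≡ (+ q′) · ((+ q) · P)
  outer q q′ d r s refl refl (a₁ , a₂ , a₃) (b₁ , b₂ , b₃) P eq =
    trans (point-≡ (c d (+ q′) r s a₁ b₁) (c d (+ q′) r s a₂ b₂) (c d (+ q′) r s a₃ b₃)) (cong ((+ q′) ·_) (sym eq))
    where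
    c : ∀ d q′ r s a b → d *ᶻ (q′ *ᶻ r *ᶻ a +ᶻ q′ *ᶻ s *ᶻ b) ≡ q′ *ᶻ (d *ᶻ (r *ᶻ a +ᶻ s *ᶻ b))
    c = ℤ-Solver.solve-∀

-- A track layout in the form that the drawing needs: `index` names the track and is the residue of
-- `z` modulo `p`, while `z` orders each track.
record Placement (G : Graph) (p : ℕ) : Set where
  field
    index : Fin (order G) → ℕ
    level : Fin (order G) → ℕ
  z : Fin (order G) → ℕ
  z v = index v + p * level v
  field
    index<p  : ∀ v → index v < p
    z-inj    : ∀ {u v} → index u ≡ index v → z u ≡ z v → u ≡ v
    proper   : ∀ {u v} → Edge G u v → index u ≢ index v
    no-cross : ∀ {v w x y} → Edge G v w → Edge G x y → index v ≡ index x → index w ≡ index y →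
               z v < z x → z y < z w → ⊥

  location : Fin (order G) → Point
  location v = + index v *ᶻ + index v , + index v *ᶻ + index v *ᶻ + index v , + index v +ᶻ + p *ᶻ + level v

private
  balance₃ : ∀ (α β γ δ f g h : ℤ) → α *ᶻ f +ᶻ β *ᶻ g ≡ γ *ᶻ f +ᶻ δ *ᶻ h →
             (α -ᶻ γ) *ᶻ f +ᶻ β *ᶻ g +ᶻ (-ᶻ δ) *ᶻ h ≡ 0ℤ
  balance₃ α β γ δ f g h eq = trans (move α γ β δ f g h) (ℤ.i≡j⇒i-j≡0 eq)
    where
    move : ∀ α γ β δ f g h → (α -ᶻ γ) *ᶻ f +ᶻ β *ᶻ g +ᶻ (-ᶻ δ) *ᶻ h ≡ (α *ᶻ f +ᶻ β *ᶻ g) -ᶻ (γ *ᶻ f +ᶻ δ *ᶻ h)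
    move = ℤ-Solver.solve-∀

  balance₂ : ∀ (α β γ δ f g : ℤ) → α *ᶻ f +ᶻ β *ᶻ g ≡ γ *ᶻ f +ᶻ δ *ᶻ g →
             (α -ᶻ γ) *ᶻ f +ᶻ (β -ᶻ δ) *ᶻ g ≡ 0ℤ
  balance₂ α β γ δ f g eq = trans (move α γ β δ f g) (ℤ.i≡j⇒i-j≡0 eq)
    where
    move : ∀ α γ β δ f g → (α -ᶻ γ) *ᶻ f +ᶻ (β -ᶻ δ) *ᶻ g ≡ (α *ᶻ f +ᶻ β *ᶻ g) -ᶻ (γ *ᶻ f +ᶻ δ *ᶻ g)
    move = ℤ-Solver.solve-∀

  balance₄ : ∀ (α β γ δ f g h k : ℤ) → α *ᶻ f +ᶻ β *ᶻ g ≡ γ *ᶻ h +ᶻ δ *ᶻ k →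
             Weighted α β (-ᶻ γ) (-ᶻ δ) f g h k ≡ 0ℤ
  balance₄ α β γ δ f g h k eq = trans (move α γ β δ f g h k) (ℤ.i≡j⇒i-j≡0 eq)
    where
    move : ∀ α γ β δ f g h k → α *ᶻ f +ᶻ β *ᶻ g +ᶻ (-ᶻ γ) *ᶻ h +ᶻ (-ᶻ δ) *ᶻ k ≡ (α *ᶻ f +ᶻ β *ᶻ g) -ᶻ (γ *ᶻ h +ᶻ δ *ᶻ k)
    move = ℤ-Solver.solve-∀

  units : ∀ (α β γ δ : ℕ) → α + β ≡ γ + δ → + α *ᶻ ℤ.1ℤ +ᶻ + β *ᶻ ℤ.1ℤ ≡ + γ *ᶻ ℤ.1ℤ +ᶻ + δ *ᶻ ℤ.1ℤ
  units α β γ δ eq = trans (cong₂ _+ᶻ_ (ℤ.*-identityʳ (+ α)) (ℤ.*-identityʳ (+ β)))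
    (trans (cong +_ eq) (sym (cong₂ _+ᶻ_ (ℤ.*-identityʳ (+ γ)) (ℤ.*-identityʳ (+ δ)))))

module _ {G : Graph} {p : ℕ} (pp : Prime p) (L : Placement G p) where

  open Placement L

  location-z : ∀ v → proj₂ (proj₂ (location v)) ≡ + z v
  location-z v = cong (+ index v +ᶻ_) (sym (ℤ.pos-* p (level v)))

  private
    V = Fin (order G)

    module M {v w x y} (M : Meeting (location v) (location w) (location x) (location y)) where
      open Meeting M public
      e₂ = cong proj₁ equation
      e₃ = cong (proj₁ ∘ proj₂) equation
      ez = cong (proj₂ ∘ proj₂) equation

      z-balance : α * z v + β * z w ≡ γ * z x + δ * z y
      z-balance = ℤ.+-injective (trans (side α v β w) (trans ez (sym (side γ x δ y))))
        where
        side : ∀ k u l t → + (k * z u + l * z t) ≡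
               + k *ᶻ proj₂ (proj₂ (location u)) +ᶻ + l *ᶻ proj₂ (proj₂ (location t))
        side k u l t = cong₂ _+ᶻ_ (trans (ℤ.pos-* k (z u)) (cong (+ k *ᶻ_) (sym (location-z u))))
                                  (trans (ℤ.pos-* l (z t)) (cong (+ l *ᶻ_) (sym (location-z t))))

  -- A common point is an affine dependence with weights α, β, -γ, -δ; independence makes α and β
  -- vanish, though their sum is positive.
  meeting-four : ∀ {v w x y} → index v ≢ index w → index v ≢ index x → index v ≢ index y →
    index w ≢ index x → index w ≢ index y → index x ≢ index y →
    ¬ Meeting (location v) (location w) (location x) (location y)
  meeting-four {v} {w} {x} {y} vw vx vy wx wy xy m =
    <-irrefl (sym (trans (cong₂ _+_ (ℤ.+-injective α≡0) (ℤ.+-injective β≡0)) refl)) positive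
    where
    open M m
    apart : ∀ {a b} → index a ≢ index b → _
    apart {a} {b} = distinct-residues pp (index<p a) (index<p b)
    dep : Dependent pp (+ index v) (+ index w) (+ index x) (+ index y) (+ level v) (+ level w) (+ level x) (+ level y)
                    (+ α) (+ β) (-ᶻ + γ) (-ᶻ + δ)
    dep = record
      { s₀ = balance (λ _ → ℤ.1ℤ) (units α β γ δ total)
      ; s₂ = balance (λ u → + index u *ᶻ + index u) e₂
      ; s₃ = balance (λ u → + index u *ᶻ + index u *ᶻ + index u) e₃
      ; sz = balance (λ u → + index u +ᶻ + p *ᶻ + level u) ez }
      where
      balance : (f : V → ℤ) → + α *ᶻ f v +ᶻ + β *ᶻ f w ≡ + γ *ᶻ f x +ᶻ + δ *ᶻ f y →
                Weighted (+ α) (+ β) (-ᶻ + γ) (-ᶻ + δ) (f v) (f w) (f x) (f y) ≡ 0ℤ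
      balance f = balance₄ (+ α) (+ β) (+ γ) (+ δ) (f v) (f w) (f x) (f y)
    α≡0 : + α ≡ 0ℤ
    α≡0 = independent pp (apart vw) (apart vx) (apart vy) (apart wx) (apart wy) (apart xy) _ _ _ _ _ _ _ _ dep
    β≡0 : + β ≡ 0ℤ
    β≡0 = independent pp (apart wx) (apart wy) (apart (≢-sym vw)) (apart xy) (apart (≢-sym vx)) (apart (≢-sym vy)) _ _ _ _ _ _ _ _
            (Dependent-rotate pp dep)

  -- Projected to the first two coordinates, `v` and `x` coincide and the three remaining points are
  -- not collinear. So all weight sits on `v` and on `x`, and comparing heights identifies them.
  meeting-three : ∀ {v w x y} → index v ≡ index x → index v ≢ index w → index v ≢ index y → index w ≢ index y →
    (m : Meeting (location v) (location w) (location x) (location y)) → v ≡ x × Meeting.β m ≡ 0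
  meeting-three {v} {w} {x} {y} vx vw vy wy m = z-inj vx (*-cancelˡ-≡ (z v) (z x) α {{>-nonZero α>0}} αz) , β≡0
    where
    open M m
    balance : (f : ℕ → ℤ) → + α *ᶻ f (index v) +ᶻ + β *ᶻ f (index w) ≡ + γ *ᶻ f (index x) +ᶻ + δ *ᶻ f (index y) →
              (+ α -ᶻ + γ) *ᶻ f (index v) +ᶻ + β *ᶻ f (index w) +ᶻ (-ᶻ + δ) *ᶻ f (index y) ≡ 0ℤ
    balance f eq = balance₃ (+ α) (+ β) (+ γ) (+ δ) (f (index v)) (f (index w)) (f (index y))
      (subst (λ i → + α *ᶻ f (index v) +ᶻ + β *ᶻ f (index w) ≡ + γ *ᶻ f i +ᶻ + δ *ᶻ f (index y)) (sym vx) eq)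
    s₂ = balance (λ i → + i *ᶻ + i) e₂
    s₃ = balance (λ i → + i *ᶻ + i *ᶻ + i) e₃
    s₀ : (+ α -ᶻ + γ) +ᶻ + β +ᶻ (-ᶻ + δ) ≡ 0ℤ
    s₀ = trans (sym (cong₂ _+ᶻ_ (cong₂ _+ᶻ_ (ℤ.*-identityʳ (+ α -ᶻ + γ)) (ℤ.*-identityʳ (+ β))) (ℤ.*-identityʳ (-ᶻ + δ))))
               (balance (λ _ → ℤ.1ℤ) (units α β γ δ total))
    α≡γ : α ≡ γ
    α≡γ = ℤ.+-injective (ℤ.i-j≡0⇒i≡j _ _ (moments₃ vw vy wy (+ α -ᶻ + γ) (+ β) (-ᶻ + δ) s₀ s₂ s₃))
    exchange : ∀ a b c → a +ᶻ b +ᶻ c ≡ 0ℤ → b +ᶻ a +ᶻ c ≡ 0ℤ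
    exchange a b c = trans (cong (_+ᶻ c) (ℤ.+-comm b a))
    exchange-at : (f : ℕ → ℤ) → (+ α -ᶻ + γ) *ᶻ f (index v) +ᶻ + β *ᶻ f (index w) +ᶻ (-ᶻ + δ) *ᶻ f (index y) ≡ 0ℤ →
                  + β *ᶻ f (index w) +ᶻ (+ α -ᶻ + γ) *ᶻ f (index v) +ᶻ (-ᶻ + δ) *ᶻ f (index y) ≡ 0ℤ
    exchange-at f = exchange ((+ α -ᶻ + γ) *ᶻ f (index v)) (+ β *ᶻ f (index w)) ((-ᶻ + δ) *ᶻ f (index y))
    β≡0 : β ≡ 0
    β≡0 = ℤ.+-injective (moments₃ (≢-sym vw) wy vy (+ β) (+ α -ᶻ + γ) (-ᶻ + δ)
      (exchange (+ α -ᶻ + γ) (+ β) (-ᶻ + δ) s₀) (exchange-at (λ i → + i *ᶻ + i) s₂) (exchange-at (λ i → + i *ᶻ + i *ᶻ + i) s₃))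
    δ≡0 : δ ≡ 0
    δ≡0 = trans (sym (+-cancelˡ-≡ γ β δ (trans (cong (_+ β) (sym α≡γ)) total))) β≡0
    α>0 : 0 < α
    α>0 = subst (0 <_) (trans (cong (λ k → α + k) β≡0) (+-identityʳ α)) positive
    αz : α * z v ≡ α * z x
    αz = begin
      α * z v                ≡⟨ +-identityʳ _ ⟨
      α * z v + 0 * z w      ≡⟨ cong (λ k → α * z v + k * z w) β≡0 ⟨
      α * z v + β * z w      ≡⟨ z-balance ⟩
      γ * z x + δ * z y      ≡⟨ cong₂ (λ k l → k * z x + l * z y) (sym α≡γ) δ≡0 ⟩
      α * z x + 0            ≡⟨ +-identityʳ _ ⟩
      α * z x                ∎
      where open ≡-Reasoning

  -- In the first coordinate the two edges have the same pair of distinct ends, and a point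
  -- determines its weights there.
  meeting-two-weights : ∀ {v w x y} → index v ≡ index x → index w ≡ index y → index v ≢ index w →
    (m : Meeting (location v) (location w) (location x) (location y)) →
    Meeting.α m ≡ Meeting.γ m × Meeting.β m ≡ Meeting.δ m
  meeting-two-weights {v} {w} {x} {y} vx wy vw m = α≡γ , +-cancelˡ-≡ γ β δ (trans (cong (_+ β) (sym α≡γ)) total)
    where
    open M m
    balance : (f : ℕ → ℤ) → + α *ᶻ f (index v) +ᶻ + β *ᶻ f (index w) ≡ + γ *ᶻ f (index x) +ᶻ + δ *ᶻ f (index y) →
              (+ α -ᶻ + γ) *ᶻ f (index v) +ᶻ (+ β -ᶻ + δ) *ᶻ f (index w) ≡ 0ℤ
    balance f eq = balance₂ (+ α) (+ β) (+ γ) (+ δ) (f (index v)) (f (index w))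
      (subst₂ (λ i j → + α *ᶻ f (index v) +ᶻ + β *ᶻ f (index w) ≡ + γ *ᶻ f i +ᶻ + δ *ᶻ f j) (sym vx) (sym wy) eq)
    α≡γ : α ≡ γ
    α≡γ = ℤ.+-injective (ℤ.i-j≡0⇒i≡j _ _ (moments₂ vw (+ α -ᶻ + γ) (+ β -ᶻ + δ)
      (trans (sym (cong₂ _+ᶻ_ (ℤ.*-identityʳ (+ α -ᶻ + γ)) (ℤ.*-identityʳ (+ β -ᶻ + δ))))
             (balance (λ _ → ℤ.1ℤ) (units α β γ δ total)))
      (balance (λ i → + i *ᶻ + i) e₂)))

  -- With equal weights only heights matter. Opposite orders at the two ends are an X-crossing,
  -- equal strict orders keep the edges apart, and a common end leaves no weight on the other one.
  meeting-two : ∀ {v w x y} → Edge G v w → Edge G x y → index v ≡ index x → index w ≡ index y → ¬ (v ≡ x × w ≡ y) →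
    (m : Meeting (location v) (location w) (location x) (location y)) →
    (v ≡ x × Meeting.β m ≡ 0) ⊎ (w ≡ y × Meeting.α m ≡ 0)
  meeting-two {v} {w} {x} {y} vw xy vx wy differ m = go (<-cmp (z v) (z x)) (<-cmp (z w) (z y))
    where
    open M m
    α≡γ = proj₁ (meeting-two-weights vx wy (proper vw) m)
    β≡δ = proj₂ (meeting-two-weights vx wy (proper vw) m)
    balanced : α * z v + β * z w ≡ α * z x + β * z y
    balanced = trans z-balance (cong₂ (λ k l → k * z x + l * z y) (sym α≡γ) (sym β≡δ))
    zero-weight : ∀ k {a b} → a ≢ b → k * a ≡ k * b → k ≡ 0
    zero-weight zero    _  _  = refl
    zero-weight (suc k) ne eq = contradiction (*-cancelˡ-≡ _ _ (suc k) eq) ne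
    strict : ∀ {a b c d} → 0 < α + β → a < b → c < d → α * a + β * c < α * b + β * d
    strict {a} {b} {c} {d} pos a<b c<d with α in αeq
    ... | zero  = *-monoʳ-< β {{>-nonZero pos}} c<d
    ... | suc k = +-mono-<-≤ (*-monoʳ-< (suc k) a<b) (*-monoʳ-≤ β (<⇒≤ c<d))
    go : _ → _ → _
    go (tri≈ _ zv≡zx _) (tri≈ _ zw≡zy _) = contradiction (z-inj vx zv≡zx , z-inj wy zw≡zy) differ
    go (tri≈ _ zv≡zx _) (tri< lt _ _) = inj₁ (z-inj vx zv≡zx , zero-weight β (<⇒≢ lt)
      (+-cancelˡ-≡ (α * z v) _ _ (trans balanced (cong (λ k → α * k + β * z y) (sym zv≡zx)))))
    go (tri≈ _ zv≡zx _) (tri> _ _ gt) = inj₁ (z-inj vx zv≡zx , zero-weight β (≢-sym (<⇒≢ gt))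
      (+-cancelˡ-≡ (α * z v) _ _ (trans balanced (cong (λ k → α * k + β * z y) (sym zv≡zx)))))
    go (tri< lt _ _) (tri≈ _ zw≡zy _) = inj₂ (z-inj wy zw≡zy , zero-weight α (<⇒≢ lt)
      (+-cancelʳ-≡ (β * z w) _ _ (trans balanced (cong (λ k → α * z x + β * k) (sym zw≡zy)))))
    go (tri> _ _ gt) (tri≈ _ zw≡zy _) = inj₂ (z-inj wy zw≡zy , zero-weight α (≢-sym (<⇒≢ gt))
      (+-cancelʳ-≡ (β * z w) _ _ (trans balanced (cong (λ k → α * z x + β * k) (sym zw≡zy)))))
    go (tri< lt _ _) (tri> _ _ gt) = ⊥-elim (no-cross vw xy vx wy lt gt)
    go (tri> _ _ gt) (tri< lt _ _) = ⊥-elim (no-cross xy vw (sym vx) (sym wy) gt lt)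
    go (tri< lt _ _) (tri< lt′ _ _) = contradiction balanced (<⇒≢ (strict positive lt lt′))
    go (tri> _ _ gt) (tri> _ _ gt′) = contradiction (sym balanced) (<⇒≢ (strict positive gt gt′))

  Shared : ℕ → Point → V → V → V → V → Set
  Shared d P v w x y = ∃[ u ] ((u ≡ v ⊎ u ≡ w) × (u ≡ x ⊎ u ≡ y) × P ≡ (+ d) · location u)

  module _ {d : ℕ} {P : Point} (0<d : 0 < d) where

    share : ∀ {v w x y} → index v ≡ index x → Edge G v w → Edge G x y → ¬ (v ≡ x × w ≡ y) →
            Between d P (location v) (location w) → Between d P (location x) (location y) → Shared d P v w x y
    share {v} {w} {x} {y} vx vw xy differ b b′ = by-cases (index w ℕ.≟ index y)
      where
      m = proj₁ (meeting 0<d b b′)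
      at-v : v ≡ x × Meeting.β m ≡ 0 → Shared d P v w x y
      at-v (v≡x , β≡0) = v , inj₁ refl , inj₁ v≡x , Between-end b (proj₁ (proj₂ (meeting 0<d b b′)) β≡0)
      at-w : w ≡ y × Meeting.α m ≡ 0 → Shared d P v w x y
      at-w (w≡y , α≡0) = w , inj₂ refl , inj₂ w≡y , Between-end (Between-sym b) (proj₂ (proj₂ (meeting 0<d b b′)) α≡0)
      by-cases : Dec (index w ≡ index y) → Shared d P v w x y
      by-cases (no wy)  = at-v (meeting-three vx (proper vw) (λ vy → proper xy (trans (sym vx) vy)) wy m)
      by-cases (yes wy) = [ at-v , at-w ]′ (meeting-two vw xy vx wy differ m)

    -- If the edges have a track in common, their ends are exchanged so that `share` applies.
    edges-meet-at-ends : ∀ {v w x y} → Edge G v w → Edge G x y → ¬ (v ≡ x × w ≡ y) → ¬ (v ≡ y × w ≡ x) →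
      Between d P (location v) (location w) → Between d P (location x) (location y) → Shared d P v w x y
    edges-meet-at-ends {v} {w} {x} {y} vw xy ne₁ ne₂ b b′
      with index v ℕ.≟ index x | index v ℕ.≟ index y | index w ℕ.≟ index x | index w ℕ.≟ index y
    ... | yes vx | _ | _ | _ = share vx vw xy ne₁ b b′
    ... | no _ | yes vy | _ | _ =
      let u , p , q , e = share vy vw (edge-sym G xy) ne₂ b (Between-sym b′) in u , p , swap q , e
    ... | no _ | no _ | yes wx | _ =
      let u , p , q , e = share wx (edge-sym G vw) xy (λ (p , q) → ne₂ (q , p)) (Between-sym b) b′ in u , swap p , q , e
    ... | no _ | no _ | no _ | yes wy =
      let u , p , q , e = share wy (edge-sym G vw) (edge-sym G xy) (λ (p , q) → ne₁ (q , p)) (Between-sym b) (Between-sym b′)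
      in u , swap p , swap q , e
    ... | no vx | no vy | no wx | no wy =
      contradiction (proj₁ (meeting 0<d b b′)) (meeting-four (proper vw) vx vy wx wy (proper xy))

module _ {G : Graph} {p : ℕ} (pp : Prime p) (L : Placement G p) where

  open Placement L

  private
    V = Fin (order G)

  private
    unit-· : ∀ P → (+ 1) · P ≡ P
    unit-· (x , y , z) = point-≡ (ℤ.*-identityˡ x) (ℤ.*-identityˡ y) (ℤ.*-identityˡ z)

    zero-combination : ∀ k P Q → k · P ≡ combination k P 0ℤ Q
    zero-combination k (x , y , z) (x′ , y′ , z′) = point-≡ (c k x x′) (c k y y′) (c k z z′)
      where
      c : ∀ k x x′ → k *ᶻ x ≡ k *ᶻ x +ᶻ 0ℤ *ᶻ x′
      c = ℤ-Solver.solve-∀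

    as-combination : ∀ {A B C} (b : Between 1 C A B) → let open Between b in
                     combination (+ r) A (+ s) B ≡ (+ (r + s)) · C
    as-combination {A} {B} b = sym (trans equation (unit-· (combination (+ r) A (+ s) B)))
      where open Between b

    -- The vertex `u` is taken as a point of a segment that ends in `u`, with all the weight there,
    -- so that the results on meeting segments apply; `far` does the same.
    near : ∀ {u v w} → index v ≡ index u → Edge G v w → Between 1 (location u) (location v) (location w) → u ≡ v
    near {u} {v} {w} vu vw b = z-inj (sym vu) (ℤ.+-injective (trans (sym (location-z pp L u)) (trans (cong (proj₂ ∘ proj₂) same) (location-z pp L v))))
      where
      open Between b
      m : Meeting (location v) (location w) (location u) (location w)
      m = record { α = r ; β = s ; γ = r + s ; δ = 0 ; total = sym (+-identityʳ _) ; positive = positive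
                 ; equation = trans (as-combination b) (zero-combination (+ (r + s)) (location u) (location w)) }
      same : location u ≡ location v
      same = trans (Between-end b (proj₂ (meeting-two-weights pp L vu refl (proper vw) m))) (unit-· (location v))

    far : ∀ {u v w} → index v ≢ index u → index w ≢ index u → Edge G v w →
          (b : Between 1 (location u) (location v) (location w)) → Between.s b ≡ 0
    far {u} {v} {w} vu wu vw b = proj₂ (meeting-three pp L refl (proper vw) vu wu m)
      where
      open Between b
      m : Meeting (location v) (location w) (location v) (location u)
      m = record { α = r ; β = s ; γ = 0 ; δ = r + s ; total = refl ; positive = positive
                 ; equation = trans (as-combination b)
                     (trans (zero-combination (+ (r + s)) (location u) (location v)) (combination-comm (+ (r + s)) (location u) 0ℤ (location v))) }

  vertex-on-edge : ∀ {u v w} → Edge G v w → Between 1 (location u) (location v) (location w) → u ≡ v ⊎ u ≡ w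
  vertex-on-edge {u} {v} {w} vw b with index v ℕ.≟ index u | index w ℕ.≟ index u
  ... | yes vu | _      = inj₁ (near vu vw b)
  ... | no _   | yes wu = inj₂ (near wu (edge-sym G vw) (Between-sym b))
  ... | no vu  | no wu  = contradiction (Between.positive b)
    (<-irrefl (sym (cong₂ _+_ (far wu vu (edge-sym G vw) (Between-sym b)) (far vu wu vw b))))

  placement⇒drawing : ∀ {A B C} → p * p ≤ A → p * p * p ≤ B → (∀ v → z v < C) → Drawing G A B C
  placement⇒drawing {A} {B} {C} p²≤A p³≤B z<C = record
    { pos = pos ; pos-inj = pos-inj
    ; edgesOK = λ v w x y vw xy ne₁ ne₂ d P 0<d on₁ on₂ →
        let u , in₁ , in₂ , eq = edges-meet-at-ends pp L 0<d vw xy ne₁ ne₂ (between v w on₁) (between x y on₂)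
        in u , in₁ , in₂ , trans eq (cong ((+ d) ·_) (sym (point u)))
    ; vertsOK = λ v w u vw on → vertex-on-edge vw (subst (λ P → Between 1 P _ _) (point u) (between v w on)) }
    where
    x< : ∀ v → index v * index v < A
    x< v = <-≤-trans (*-mono-< (index<p v) (index<p v)) p²≤A
    y< : ∀ v → index v * index v * index v < B
    y< v = <-≤-trans (*-mono-< (*-mono-< (index<p v) (index<p v)) (index<p v)) p³≤B
    pos : V → Fin A × Fin B × Fin C
    pos v = fromℕ< (x< v) , fromℕ< (y< v) , fromℕ< (z<C v)
    square-inj : ∀ {i j} → i * i ≡ j * j → i ≡ j
    square-inj {i} {j} eq with <-cmp i j
    ... | tri< lt _ _ = contradiction eq (<⇒≢ (*-mono-< lt lt))
    ... | tri≈ _ i≡j _ = i≡j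
    ... | tri> _ _ gt = contradiction (sym eq) (<⇒≢ (*-mono-< gt gt))
    pos-inj : Injective _≡_ _≡_ pos
    pos-inj {u} {v} eq = z-inj (square-inj (fromℕ<-injective _ _ (x< u) (x< v) (cong proj₁ eq)))
                               (fromℕ<-injective _ _ (z<C u) (z<C v) (cong (proj₂ ∘ proj₂) eq))
    point : ∀ v → toPoint (pos v) ≡ location v
    point v = point-≡
      (trans (cong +_ (toℕ-fromℕ< (x< v))) (ℤ.pos-* i i))
      (trans (cong +_ (toℕ-fromℕ< (y< v))) (trans (ℤ.pos-* (i * i) i) (cong (_*ᶻ + i) (ℤ.pos-* i i))))
      (trans (cong +_ (toℕ-fromℕ< (z<C v))) (sym (location-z pp L v)))
      where i = index v
    between : ∀ v w {d P} → OnSeg d P (toPoint (pos v)) (toPoint (pos w)) → Between d P (location v) (location w)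
    between v w {d} {P} on = OnSeg⇒Between (subst₂ (OnSeg d P) (point v) (point w) on)

-- Placements of linear height

count-true : ∀ m → count {m} (λ _ → true) ≡ m
count-true zero    = refl
count-true (suc m) = cong suc (count-true m)

-- Closes the gaps between keys, so that cutting the list by position yields chunks of bounded
-- number and length.
module Position {m} (key : Fin m → ℕ) where

  position : Fin m → ℕ
  position v = count (λ u → does (key u <? key v))

  private
    suc-position : ∀ v → sum (λ u → ind (does (key u <? key v)) + at v 1 u) ≡ suc (position v)
    suc-position v = trans (sum-+-at _ v 1) (+-comm _ 1)

  position<m : ∀ v → position v < m
  position<m v = begin
    suc (position v)                                       ≡⟨ suc-position v ⟨
    sum (λ u → ind (does (key u <? key v)) + at v 1 u)     ≤⟨ sum-mono-≤ pt ⟩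
    count {m} (λ _ → true)                                 ≡⟨ count-true m ⟩
    m                                                      ∎
    where
    open ≤-Reasoning
    pt : ∀ u → ind (does (key u <? key v)) + at v 1 u ≤ 1
    pt u with u ≟ v
    ... | yes refl rewrite dec-false (key v <? key v) (<-irrefl refl) = ≤-refl
    ... | no _     = ≤-trans (≤-reflexive (+-identityʳ _)) (ind-mono {b = true} (λ _ → refl))

  position-mono-< : ∀ {v w} → key v < key w → position v < position w
  position-mono-< {v} {w} lt = begin
    suc (position v)                                       ≡⟨ suc-position v ⟨
    sum (λ u → ind (does (key u <? key v)) + at v 1 u)     ≤⟨ sum-mono-≤ pt ⟩
    position w                                             ∎
    where
    open ≤-Reasoning
    pt : ∀ u → ind (does (key u <? key v)) + at v 1 u ≤ ind (does (key u <? key w))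
    pt u with u ≟ v
    ... | yes refl rewrite dec-false (key v <? key v) (<-irrefl refl) | dec-true (key v <? key w) lt = ≤-refl
    ... | no _     = ≤-trans (≤-reflexive (+-identityʳ _)) (ind-mono (λ q →
                       dec-true (key u <? key w) (<-trans (from-does (key u <? key v) q) lt)))

  position-cancel-< : Injective _≡_ _≡_ key → ∀ {v w} → position v < position w → key v < key w
  position-cancel-< key-inj {v} {w} lt with <-cmp (key v) (key w)
  ... | tri< lt′ _ _ = lt′
  ... | tri≈ _ eq _ with refl ← key-inj eq = contradiction lt (<-irrefl refl)
  ... | tri> _ _ gt = contradiction lt (<-asym (position-mono-< gt))

-- If `p` exceeds the number of vertices, indices up to `p` could be too high for a linear bound;
-- giving each vertex its own track keeps `z` below the order.
small-placement : ∀ G {p} → order G ≤ p → Placement G p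
small-placement G {p} n≤p = record
  { index = toℕ ; level = λ _ → 0
  ; index<p = λ v → <-≤-trans (toℕ<n v) n≤p
  ; z-inj = λ eq _ → toℕ-injective eq
  ; proper = λ e eq → proper e (toℕ-injective eq)
  ; no-cross = λ _ _ vx _ v<x → contradiction v<x (<-irrefl (cong (_+ p * 0) vx)) }
  where
  proper : ∀ {u v} → Edge G u v → u ≢ v
  proper e refl = edge-irr G e

-- The tracks, listed one after the other, are cut into chunks of equal length.
-- Track number plus chunk number is injective on the resulting pieces, since both
-- are nondecreasing along the list.
module LargePlacement {G : Graph} {t p : ℕ} (T : TrackLayout G t) {{_ : NonZero p}}
                      (2t≤p : 2 * t ≤ p) (p≤n : p ≤ order G) where

  open TrackLayout T
  open Lex (toℕ ∘ track) rank rank-inj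
  open Position key

  private
    V = Fin (order G)
    -- Just above 2n / p: chunk numbers stay below p / 2, which with `2 * t ≤ p` keeps `index` below
    -- `p`, and `p * len` is still at most 3n.
    len : ℕ
    len = suc (2 * order G / p)

  index : V → ℕ
  index v = toℕ (track v) + position v / len

  level : V → ℕ
  level v = position v % len

  2n<len*p : 2 * order G < len * p
  2n<len*p = begin-strict
    2 * order G                                        ≡⟨ m≡m%n+[m/n]*n (2 * order G) p ⟩
    2 * order G % p + 2 * order G / p * p              <⟨ +-monoˡ-< _ (m%n<n (2 * order G) p) ⟩
    p + 2 * order G / p * p                            ∎
    where open ≤-Reasoning

  chunks : ∀ v → 2 * (position v / len) < p
  chunks v = *-cancelʳ-< len _ _ (begin-strict
    2 * (position v / len) * len     ≡⟨ *-assoc 2 (position v / len) len ⟩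
    2 * (position v / len * len)     ≤⟨ *-monoʳ-≤ 2 (m/n*n≤m (position v) len) ⟩
    2 * position v                   ≤⟨ *-monoʳ-≤ 2 (<⇒≤ (position<m v)) ⟩
    2 * order G                      <⟨ 2n<len*p ⟩
    len * p                          ≡⟨ *-comm len p ⟩
    p * len                          ∎)
    where open ≤-Reasoning

  index<p : ∀ v → index v < p
  index<p v = *-cancelˡ-< 2 _ _ (begin-strict
    2 * index v                                        ≡⟨ *-distribˡ-+ 2 (toℕ (track v)) _ ⟩
    2 * toℕ (track v) + 2 * (position v / len)         <⟨ +-mono-≤-< (*-monoʳ-≤ 2 (<⇒≤ (toℕ<n (track v)))) (chunks v) ⟩
    2 * t + p                                          ≤⟨ +-monoˡ-≤ p 2t≤p ⟩
    p + p                                              ≡⟨ cong (λ k → p + k) (+-identityʳ p) ⟨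
    2 * p                                              ∎)
    where open ≤-Reasoning

  private
    both : ∀ {a b c d} → a ≤ c → b ≤ d → a + b ≡ c + d → a ≡ c × b ≡ d
    both {a} {b} {c} {d} a≤c b≤d eq with m≤n⇒m<n∨m≡n a≤c
    ... | inj₁ a<c  = contradiction eq (<⇒≢ (+-mono-<-≤ a<c b≤d))
    ... | inj₂ refl = refl , +-cancelˡ-≡ a b d eq

    same-piece-< : ∀ {u v} → key u < key v → index u ≡ index v →
                   track u ≡ track v × position u / len ≡ position v / len
    same-piece-< lt eq = let p , q = both (key<⇒track≤ lt) (/-monoˡ-≤ len (<⇒≤ (position-mono-< lt))) eq
                         in toℕ-injective p , q

  same-piece : ∀ {u v} → index u ≡ index v → track u ≡ track v × position u / len ≡ position v / len
  same-piece {u} {v} eq with <-cmp (key u) (key v)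
  ... | tri< lt _ _ = same-piece-< lt eq
  ... | tri≈ _ same _ with refl ← key-inj same = refl , refl
  ... | tri> _ _ gt = let p , q = same-piece-< gt (sym eq) in sym p , sym q

  position-< : ∀ {u v} → index u ≡ index v → level u < level v → position u < position v
  position-< {u} {v} eq lt = begin-strict
    position u                                  ≡⟨ m≡m%n+[m/n]*n (position u) len ⟩
    level u + position u / len * len            <⟨ +-monoˡ-< _ lt ⟩
    level v + position u / len * len            ≡⟨ cong (λ c → level v + c * len) (proj₂ (same-piece eq)) ⟩
    level v + position v / len * len            ≡⟨ m≡m%n+[m/n]*n (position v) len ⟨
    position v                                  ∎
    where open ≤-Reasoning

  level-inj : ∀ {u v} → index u ≡ index v → level u ≡ level v → u ≡ v
  level-inj {u} {v} eq same with <-cmp (key u) (key v)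
  ... | tri≈ _ k≡ _ = key-inj k≡
  ... | tri< lt _ _ = contradiction position-≡ (<⇒≢ (position-mono-< lt))
    where
    position-≡ : position u ≡ position v
    position-≡ = trans (m≡m%n+[m/n]*n (position u) len)
      (trans (cong₂ (λ l c → l + c * len) same (proj₂ (same-piece eq))) (sym (m≡m%n+[m/n]*n (position v) len)))
  ... | tri> _ _ gt = contradiction position-≡ (<⇒≢ (position-mono-< gt))
    where
    position-≡ : position v ≡ position u
    position-≡ = trans (m≡m%n+[m/n]*n (position v) len)
      (trans (cong₂ (λ l c → l + c * len) (sym same) (sym (proj₂ (same-piece eq)))) (sym (m≡m%n+[m/n]*n (position u) len)))

  rank-< : ∀ {u v} → index u ≡ index v → index u + p * level u < index v + p * level v → rank u < rank v
  rank-< {u} {v} eq lt = key<⇒rank< (cong toℕ (proj₁ (same-piece eq))) (position-cancel-< key-inj (position-< eq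
    (*-cancelˡ-< p _ _ (+-cancelˡ-< (index v) _ _ (subst (λ i → i + p * level u < index v + p * level v) eq lt)))))

  placement : Placement G p
  placement = record
    { index = index ; level = level ; index<p = index<p
    ; z-inj = λ {u} {v} eq z≡ → level-inj eq (*-cancelˡ-≡ _ _ p (+-cancelˡ-≡ (index v) _ _
        (subst (λ i → i + p * level u ≡ index v + p * level v) eq z≡)))
    ; proper = λ e eq → proper _ _ e (proj₁ (same-piece eq))
    ; no-cross = λ vw xy vx wy v<x y<w → noX _ _ _ _ vw xy (proj₁ (same-piece vx)) (proj₁ (same-piece wy))
                   (rank-< vx v<x) (rank-< (sym wy) y<w) }

  z<3n : ∀ v → Placement.z placement v < 3 * order G
  z<3n v = begin-strict
    index v + p * level v           <⟨ +-monoˡ-< (p * level v) (index<p v) ⟩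
    p + p * level v                 ≡⟨ *-suc p (level v) ⟨
    p * suc (level v)               ≤⟨ *-monoʳ-≤ p (m%n<n (position v) len) ⟩
    p * len                         ≡⟨ *-comm p len ⟩
    p + 2 * order G / p * p         ≤⟨ +-mono-≤ p≤n (m/n*n≤m (2 * order G) p) ⟩
    3 * order G                     ∎
    where open ≤-Reasoning

-- Bounds may be zero for a graph without vertices, where neither `prime-above` nor the estimate of
-- 1 + 2q by 3q applies.
vertex-free⇒drawing : ∀ {G A B C} → ¬ Fin (order G) → Drawing G A B C
vertex-free⇒drawing empty = record
  { pos = ⊥-elim ∘ empty ; pos-inj = λ {u} → ⊥-elim (empty u)
  ; edgesOK = λ v → ⊥-elim (empty v) ; vertsOK = λ v → ⊥-elim (empty v) }

vertex-free⇒track : ∀ {G t} → ¬ Fin (order G) → TrackLayout G t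
vertex-free⇒track empty = record
  { track = ⊥-elim ∘ empty ; proper = λ v → ⊥-elim (empty v) ; rank = ⊥-elim ∘ empty
  ; rank-inj = λ {u} → ⊥-elim (empty u) ; noX = λ v → ⊥-elim (empty v) }

inhabited? : ∀ m → Dec (Fin m)
inhabited? zero    = no ¬Fin0
inhabited? (suc m) = yes zero

Fin⇒>0 : ∀ {m} → Fin m → 0 < m
Fin⇒>0 {suc _} _ = s≤s z≤n

track⇒drawing : ∀ {G t} → TrackLayout G t → let b = 512 * t ^ 4 in Drawing G (b * b) (b * b * b) (3 * order G)
track⇒drawing {G} {t} T with inhabited? (order G)
... | no empty = vertex-free⇒drawing empty
... | yes v with p , pp , 2t≤p , p≤b ← prime-above t (Fin⇒>0 (TrackLayout.track T v)) with ≤-total (order G) p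
...   | inj₁ n≤p = placement⇒drawing pp (small-placement G n≤p) (*-mono-≤ p≤b p≤b) (*-mono-≤ (*-mono-≤ p≤b p≤b) p≤b) z<
  where
  z< : ∀ u → toℕ u + p * 0 < 3 * order G
  z< u rewrite *-zeroʳ p | +-identityʳ (toℕ u) = <-≤-trans (toℕ<n u) (m≤m+n (order G) _)
...   | inj₂ p≤n = placement⇒drawing pp placement (*-mono-≤ p≤b p≤b) (*-mono-≤ (*-mono-≤ p≤b p≤b) p≤b) z<3n
  where
  instance _ = prime⇒nonZero pp
  open LargePlacement T 2t≤p p≤n

-- The equivalences for graph families

TrackLayout-mono : ∀ {G t t′} → t ≤ t′ → TrackLayout G t → TrackLayout G t′
TrackLayout-mono le T = record
  { track = λ v → inject≤ (track v) le
  ; proper = λ u v e eq → proper u v e (inject≤-injective le le _ _ eq)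
  ; rank = rank ; rank-inj = rank-inj
  ; noX = λ v w x y vw xy p q → noX v w x y vw xy (inject≤-injective le le _ _ p) (inject≤-injective le le _ _ q) }
  where open TrackLayout T

module _ {F : (ℕ → ℕ) → Set} (FC : FunctionClass F) where

  open FunctionClass FC

  F-scale : ∀ c {f} → F f → F (λ m → c * f m)
  F-scale c {f} Ff = closed-O f _ Ff (c , 0 , λ _ _ → ≤-refl)

  F-power : ∀ k {f} → F f → F (λ m → f m ^ k)
  F-power zero    Ff = has-const
  F-power (suc k) Ff = closed-mul _ _ Ff (F-power k Ff)

  module _ (𝒢 : GraphFamily) where

    drawing⇒track-family : DrawingCond 𝒢 F → TrackCond 𝒢 F
    drawing⇒track-family (A , B , C , FA , FB , _ , draw) =
      _ , F-scale 2 (closed-mul A B FA FB) , λ G G∈ → drawing⇒track (draw G G∈)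

    track⇒drawing-family : TrackCond 𝒢 F → DrawingCond 𝒢 F
    track⇒drawing-family (f , Ff , layout) =
      _ , _ , _ , closed-mul _ _ Fb Fb , closed-mul _ _ (closed-mul _ _ Fb Fb) Fb , (3 , 0 , λ _ _ → ≤-refl) ,
      λ G G∈ → track⇒drawing (layout G G∈)
      where
      Fb : F (λ m → 512 * f m ^ 4)
      Fb = F-scale 512 (F-power 4 Ff)

    track⇒queue-family : TrackCond 𝒢 F → QueueCond 𝒢 F
    track⇒queue-family (f , Ff , layout) = _ , closed-mul f f Ff Ff , λ G G∈ → track⇒queue (layout G G∈)

    -- 1 + 2 f is bounded by 3 f because F need not be closed under addition.
    queue⇒track-family : MinorClosed 𝒢 → Proper 𝒢 → QueueCond 𝒢 F → TrackCond 𝒢 F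
    queue⇒track-family closed (H , H∉) (f , Ff , layout) =
      (λ m → c * (3 * f m) ^ c) , F-scale c (F-power c (F-scale 3 Ff)) , tracks
      where
      c = starColours (order H)
      tracks : ∀ G → 𝒢 G → TrackLayout G (c * (3 * f (order G)) ^ c)
      tracks G G∈ with inhabited? (order G)
      ... | no empty = vertex-free⇒track empty
      -- `queue` is total, so its value at the pair `v`, `v` shows that there is at least one queue.
      ... | yes v = TrackLayout-mono (*-monoʳ-≤ c (^-monoˡ-≤ c (+-monoˡ-≤ (2 * f (order G)) (Fin⇒>0 (QueueLayout.queue Q v v)))))
                      (queue⇒track (starColouring (order H) G free) Q)
        where
        Q = layout G G∈
        free : ¬ CliqueMinor (2 + order H) G
        free K = H∉ (closed G H G∈ (CliqueMinor⇒IsMinor G H K))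

theorem2p10 : (𝒢 : GraphFamily) → MinorClosed 𝒢 → Proper 𝒢 →
    (F : (ℕ → ℕ) → Set) → FunctionClass F →
    (DrawingCond 𝒢 F ⇔ TrackCond 𝒢 F) × (TrackCond 𝒢 F ⇔ QueueCond 𝒢 F)
theorem2p10 𝒢 closed proper F FC =
  mk⇔ (drawing⇒track-family FC 𝒢) (track⇒drawing-family FC 𝒢) ,
  mk⇔ (track⇒queue-family FC 𝒢) (queue⇒track-family FC 𝒢 closed proper)
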